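{- Let $a,b,c$ be complex numbers. The generating function $$g(x)=\frac{1}{1-ax-bx^2}\,C\left(\frac{ -x^2(b+cx)}{(1-ax-bx^2)^2}\right)$$ is involutory, where $C(x)=\frac{1-\sqrt{1-4x}}{2x}=\sum_{n\ge 0}\frac{1}{n+1}\binom{2n}{n}x^n$ is the generating function of the Catalan numbers.
   Context: All power series are formal, with complex coefficients. The symbol $c$ is a scalar parameter; $C(\cdot)$ is the Catalan generating function. Riordan arrays: for $g(x)=1+g_1x+\cdots$ and $f(x)=f_1x+f_2x^2+\cdots$ with $f_1\neq 0$, the Riordan array $(g(x),f(x))$ is the infinite lower triangular matrix with entries $t_{n,k}=[x^n]\,g(x)f(x)^k$, $n,k\ge 0$. The product of Riordan arrays is $(g,f)\cdot(u,v)=(g(x)u(f(x)),v(f(x)))$, and the identity is $(1,x)$. A power series $g(x)$ with $g(0)=1$ is called involutory if $(g(x),-xg(x))^2=(1,x)$, i.e. if the Bell array $(g(x),xg(x))$ is a pseudo-involution. -}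

module Defs where

open import Level using (_⊔_; 0ℓ)
open import Algebra.Bundles using (CommutativeRing)
import Algebra.Definitions
import Algebra.Definitions.RawMonoid
import Algebra.Properties.CommutativeSemigroup
import Algebra.Properties.Ring
import Relation.Binary.Reasoning.Setoid
open import Data.Fin.Base using (toℕ)
open import Data.Nat.Base as ℕ using (ℕ; zero; suc)
open import Data.Nat.Combinatorics using (_C_)
import Data.Nat.Properties as ℕ
open import Data.Integer.Base using (+_)
open import Data.Product.Base using (∃; _×_; _,_; proj₁; proj₂)
open import Data.Rational.Base as ℚ using (ℚ; 0ℚ; 1ℚ; ½; ∣_∣)
import Data.Rational.Properties as ℚ
open import Data.Rational.Solver using (module +-*-Solver)
open import Relation.Binary.PropositionalEquality
  using (_≡_; refl; sym; trans; cong; subst)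

-- ℝ consists of the Cauchy sequences of rationals, up to null sequences.
-- Near s s says that s is Cauchy; for Cauchy sequences s and t, Near s t
-- holds iff s n - t n tends to 0.

record Near (s t : ℕ → ℚ) : Set where
  constructor near
  field
    modulus : ∀ ε → 0ℚ ℚ.< ε →
              ∃ λ N → ∀ m n → N ℕ.≤ m → N ℕ.≤ n → ∣ s m ℚ.- t n ∣ ℚ.< ε

open Near

record ℝ : Set where
  no-eta-equality
  field
    seq    : ℕ → ℚ
    cauchy : Near seq seq

open ℝ

infix 4 _≈ᴿ_

record _≈ᴿ_ (x y : ℝ) : Set where
  constructor ⟨_⟩
  field
    near-seq : Near (seq x) (seq y)

open _≈ᴿ_

private

  module _ where
    open +-*-Solver

    split : ∀ p q r → p ℚ.- r ≡ (p ℚ.- q) ℚ.+ (q ℚ.- r)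
    split = solve 3 (λ p q r → p :- r := (p :- q) :+ (q :- r)) refl

    split-+ : ∀ p q r s → (p ℚ.+ q) ℚ.- (r ℚ.+ s) ≡ (p ℚ.- r) ℚ.+ (q ℚ.- s)
    split-+ = solve 4 (λ p q r s → (p :+ q) :- (r :+ s) := (p :- r) :+ (q :- s)) refl

    split-* : ∀ p q r s →
              p ℚ.* q ℚ.- r ℚ.* s ≡ p ℚ.* (q ℚ.- s) ℚ.+ s ℚ.* (p ℚ.- r)
    split-* = solve 4 (λ p q r s →
      p :* q :- r :* s := p :* (q :- s) :+ s :* (p :- r)) refl

    swap : ∀ p q → p ℚ.- q ≡ ℚ.- (q ℚ.- p)
    swap = solve 2 (λ p q → p :- q := :- (q :- p)) refl

    swap-neg : ∀ p q → ℚ.- p ℚ.- ℚ.- q ≡ ℚ.- (p ℚ.- q)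
    swap-neg = solve 2 (λ p q → :- p :- :- q := :- (p :- q)) refl

    cancel : ∀ p q → p ≡ (p ℚ.- q) ℚ.+ q
    cancel = solve 2 (λ p q → p := (p :- q) :+ q) refl

    halves : ∀ ε → ½ ℚ.* ε ℚ.+ ½ ℚ.* ε ≡ ε
    halves = solve 1 (λ ε → con ½ :* ε :+ con ½ :* ε := ε) refl

  0<½* : ∀ {ε} → 0ℚ ℚ.< ε → 0ℚ ℚ.< ½ ℚ.* ε
  0<½* {ε} 0<ε = subst (ℚ._< ½ ℚ.* ε) (ℚ.*-zeroʳ ½) (ℚ.*-monoʳ-<-pos ½ 0<ε)

  ∣-∣-sym : ∀ {ε} p q → ∣ q ℚ.- p ∣ ℚ.< ε → ∣ p ℚ.- q ∣ ℚ.< ε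
  ∣-∣-sym {ε} p q = subst (ℚ._< ε)
    (sym (trans (cong ∣_∣ (swap p q)) (ℚ.∣-p∣≡∣p∣ (q ℚ.- p))))

  ∣+∣<ε : ∀ {ε} p q → ∣ p ∣ ℚ.< ½ ℚ.* ε → ∣ q ∣ ℚ.< ½ ℚ.* ε → ∣ p ℚ.+ q ∣ ℚ.< ε
  ∣+∣<ε {ε} p q p< q< = begin-strict
    ∣ p ℚ.+ q ∣           ≤⟨ ℚ.∣p+q∣≤∣p∣+∣q∣ p q ⟩
    ∣ p ∣ ℚ.+ ∣ q ∣       <⟨ ℚ.+-mono-< p< q< ⟩
    ½ ℚ.* ε ℚ.+ ½ ℚ.* ε   ≡⟨ halves ε ⟩
    ε                     ∎
    where open ℚ.≤-Reasoning

  quot : ∀ {B} → 0ℚ ℚ.< B → ℚ → ℚ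
  quot {B} 0<B ε = ε ℚ.* (ℚ.1/ B) {{ℚ.>-nonZero 0<B}}

  0<quot : ∀ {B ε} (0<B : 0ℚ ℚ.< B) → 0ℚ ℚ.< ε → 0ℚ ℚ.< quot 0<B ε
  0<quot {B} {ε} 0<B 0<ε =
    subst (ℚ._< quot 0<B ε) (ℚ.*-zeroˡ B⁻¹) (ℚ.*-monoˡ-<-pos B⁻¹ {{pos}} 0<ε)
    where
    B⁻¹ = (ℚ.1/ B) {{ℚ.>-nonZero 0<B}}
    pos : ℚ.Positive B⁻¹
    pos = ℚ.1/pos⇒pos B {{ℚ.positive 0<B}}

  ∣*∣<ε : ∀ {B ε} (0<B : 0ℚ ℚ.< B) p q →
          ∣ p ∣ ℚ.≤ B → ∣ q ∣ ℚ.< quot 0<B ε → ∣ p ℚ.* q ∣ ℚ.< ε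
  ∣*∣<ε {B} {ε} 0<B p q p≤B q< = begin-strict
    ∣ p ℚ.* q ∣          ≡⟨ ℚ.∣p*q∣≡∣p∣*∣q∣ p q ⟩
    ∣ p ∣ ℚ.* ∣ q ∣      ≤⟨ ℚ.*-monoʳ-≤-nonNeg ∣ q ∣ {{ℚ.nonNegative (ℚ.0≤∣p∣ q)}} p≤B ⟩
    B ℚ.* ∣ q ∣          <⟨ ℚ.*-monoʳ-<-pos B {{ℚ.positive 0<B}} q< ⟩
    B ℚ.* (ε ℚ.* B⁻¹)    ≡⟨ ℚ.*-comm B _ ⟩
    (ε ℚ.* B⁻¹) ℚ.* B    ≡⟨ ℚ.*-assoc ε B⁻¹ B ⟩
    ε ℚ.* (B⁻¹ ℚ.* B)    ≡⟨ cong (ε ℚ.*_) (ℚ.*-inverseˡ B {{ℚ.>-nonZero 0<B}}) ⟩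
    ε ℚ.* 1ℚ             ≡⟨ ℚ.*-identityʳ ε ⟩
    ε                    ∎
    where
    open ℚ.≤-Reasoning
    B⁻¹ = (ℚ.1/ B) {{ℚ.>-nonZero 0<B}}

  EventuallyBounded : (ℕ → ℚ) → Set
  EventuallyBounded s =
    ∃ λ B → 0ℚ ℚ.< B × (∃ λ N → ∀ n → N ℕ.≤ n → ∣ s n ∣ ℚ.≤ B)

  cauchy⇒bounded : ∀ s → Near s s → EventuallyBounded s
  cauchy⇒bounded s s-cauchy with modulus s-cauchy 1ℚ (ℚ.positive⁻¹ 1ℚ)
  ... | N , close = 1ℚ ℚ.+ ∣ s N ∣ , 0<B , N , bound
    where
    0<B : 0ℚ ℚ.< 1ℚ ℚ.+ ∣ s N ∣
    0<B = ℚ.+-mono-<-≤ (ℚ.positive⁻¹ 1ℚ) (ℚ.0≤∣p∣ (s N))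
    open ℚ.≤-Reasoning
    bound : ∀ n → N ℕ.≤ n → ∣ s n ∣ ℚ.≤ 1ℚ ℚ.+ ∣ s N ∣
    bound n N≤n = begin
      ∣ s n ∣                       ≡⟨ cong ∣_∣ (cancel (s n) (s N)) ⟩
      ∣ (s n ℚ.- s N) ℚ.+ s N ∣     ≤⟨ ℚ.∣p+q∣≤∣p∣+∣q∣ (s n ℚ.- s N) (s N) ⟩
      ∣ s n ℚ.- s N ∣ ℚ.+ ∣ s N ∣   ≤⟨ ℚ.+-monoˡ-≤ ∣ s N ∣ (ℚ.<⇒≤ (close n N N≤n ℕ.≤-refl)) ⟩
      1ℚ ℚ.+ ∣ s N ∣                ∎

  ⊔≤ˡ : ∀ {M N n} → M ℕ.⊔ N ℕ.≤ n → M ℕ.≤ n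
  ⊔≤ˡ {M} {N} = ℕ.≤-trans (ℕ.m≤m⊔n M N)

  ⊔≤ʳ : ∀ {M N n} → M ℕ.⊔ N ℕ.≤ n → N ℕ.≤ n
  ⊔≤ʳ {M} {N} = ℕ.≤-trans (ℕ.m≤n⊔m M N)

  near-sym : ∀ {s t} → Near s t → Near t s
  near-sym {s} {t} s~t .modulus ε 0<ε with modulus s~t ε 0<ε
  ... | N , close = N , λ m n N≤m N≤n → ∣-∣-sym (t m) (s n) (close n m N≤n N≤m)

  near-trans : ∀ {s t u} → Near s t → Near t u → Near s u
  near-trans {s} {t} {u} s~t t~u .modulus ε 0<ε
    with modulus s~t (½ ℚ.* ε) (0<½* 0<ε) | modulus t~u (½ ℚ.* ε) (0<½* 0<ε)
  ... | M , closeM | N , closeN = M ℕ.⊔ N , λ m n ≤m ≤n →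
    subst (λ p → ∣ p ∣ ℚ.< ε) (sym (split (s m) (t m) (u n)))
      (∣+∣<ε _ _ (closeM m m (⊔≤ˡ ≤m) (⊔≤ˡ ≤m)) (closeN m n (⊔≤ʳ ≤m) (⊔≤ʳ ≤n)))

  near-+ : ∀ {s s′ t t′} → Near s s′ → Near t t′ →
           Near (λ n → s n ℚ.+ t n) (λ n → s′ n ℚ.+ t′ n)
  near-+ {s} {s′} {t} {t′} s~s′ t~t′ .modulus ε 0<ε
    with modulus s~s′ (½ ℚ.* ε) (0<½* 0<ε) | modulus t~t′ (½ ℚ.* ε) (0<½* 0<ε)
  ... | M , closeM | N , closeN = M ℕ.⊔ N , λ m n ≤m ≤n →
    subst (λ p → ∣ p ∣ ℚ.< ε) (sym (split-+ (s m) (t m) (s′ n) (t′ n)))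
      (∣+∣<ε _ _ (closeM m n (⊔≤ˡ ≤m) (⊔≤ˡ ≤n)) (closeN m n (⊔≤ʳ ≤m) (⊔≤ʳ ≤n)))

  near-neg : ∀ {s t} → Near s t → Near (λ n → ℚ.- s n) (λ n → ℚ.- t n)
  near-neg {s} {t} s~t .modulus ε 0<ε with modulus s~t ε 0<ε
  ... | N , close = N , λ m n N≤m N≤n → subst (ℚ._< ε)
    (sym (trans (cong ∣_∣ (swap-neg (s m) (t n))) (ℚ.∣-p∣≡∣p∣ (s m ℚ.- t n))))
    (close m n N≤m N≤n)

  near-* : ∀ {s s′ t t′} → EventuallyBounded s → EventuallyBounded t′ →
           Near s s′ → Near t t′ →
           Near (λ n → s n ℚ.* t n) (λ n → s′ n ℚ.* t′ n)
  near-* {s} {s′} {t} {t′} (A , 0<A , K , s≤A) (B , 0<B , L , t′≤B) s~s′ t~t′ .modulus ε 0<ε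
    with modulus s~s′ (quot 0<B (½ ℚ.* ε)) (0<quot 0<B (0<½* 0<ε))
       | modulus t~t′ (quot 0<A (½ ℚ.* ε)) (0<quot 0<A (0<½* 0<ε))
  ... | M , closeM | N , closeN = (K ℕ.⊔ L) ℕ.⊔ (M ℕ.⊔ N) , λ m n ≤m ≤n →
    subst (λ p → ∣ p ∣ ℚ.< ε) (sym (split-* (s m) (t m) (s′ n) (t′ n)))
      (∣+∣<ε _ _
        (∣*∣<ε 0<A (s m) (t m ℚ.- t′ n) (s≤A m (⊔≤ˡ {K} (⊔≤ˡ ≤m)))
          (closeN m n (⊔≤ʳ {M} (⊔≤ʳ {K ℕ.⊔ L} ≤m)) (⊔≤ʳ {M} (⊔≤ʳ {K ℕ.⊔ L} ≤n))))
        (∣*∣<ε 0<B (t′ n) (s m ℚ.- s′ n) (t′≤B n (⊔≤ʳ {K} (⊔≤ˡ ≤n)))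
          (closeM m n (⊔≤ˡ {M} (⊔≤ʳ {K ℕ.⊔ L} ≤m)) (⊔≤ˡ {M} (⊔≤ʳ {K ℕ.⊔ L} ≤n)))))

  bounded : (x : ℝ) → EventuallyBounded (seq x)
  bounded x = cauchy⇒bounded (seq x) (cauchy x)

  pointwise : (x y : ℝ) → (∀ n → seq x n ≡ seq y n) → x ≈ᴿ y
  pointwise x y x≡y .near-seq .modulus ε 0<ε with modulus (cauchy x) ε 0<ε
  ... | N , close = N , λ m n N≤m N≤n →
    subst (λ p → ∣ seq x m ℚ.- p ∣ ℚ.< ε) (x≡y n) (close m n N≤m N≤n)

infixl 6 _+ᴿ_
infixl 7 _*ᴿ_
infix  8 -ᴿ_

_+ᴿ_ : ℝ → ℝ → ℝ
(x +ᴿ y) .seq n  = seq x n ℚ.+ seq y n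
(x +ᴿ y) .cauchy = near-+ (cauchy x) (cauchy y)

_*ᴿ_ : ℝ → ℝ → ℝ
(x *ᴿ y) .seq n  = seq x n ℚ.* seq y n
(x *ᴿ y) .cauchy = near-* (bounded x) (bounded y) (cauchy x) (cauchy y)

-ᴿ_ : ℝ → ℝ
(-ᴿ x) .seq n  = ℚ.- seq x n
(-ᴿ x) .cauchy = near-neg (cauchy x)

fromℚᴿ : ℚ → ℝ
fromℚᴿ q .seq _ = q
fromℚᴿ q .cauchy .modulus ε 0<ε =
  0 , λ _ _ _ _ → subst (λ p → ∣ p ∣ ℚ.< ε) (sym (ℚ.+-inverseʳ q)) 0<ε

record ℂ : Set where
  no-eta-equality
  field
    re im : ℝ

open ℂ

infix 4 _≈ᶜ_

record _≈ᶜ_ (z w : ℂ) : Set where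
  constructor _,_
  field
    re-≈ : re z ≈ᴿ re w
    im-≈ : im z ≈ᴿ im w

infixl 6 _+ᶜ_
infixl 7 _*ᶜ_
infix  8 -ᶜ_

_+ᶜ_ : ℂ → ℂ → ℂ
(z +ᶜ w) .re = re z +ᴿ re w
(z +ᶜ w) .im = im z +ᴿ im w

_*ᶜ_ : ℂ → ℂ → ℂ
(z *ᶜ w) .re = re z *ᴿ re w +ᴿ -ᴿ (im z *ᴿ im w)
(z *ᶜ w) .im = re z *ᴿ im w +ᴿ im z *ᴿ re w

-ᶜ_ : ℂ → ℂ
(-ᶜ z) .re = -ᴿ re z
(-ᶜ z) .im = -ᴿ im z

fromℚ : ℚ → ℂ
fromℚ q .re = fromℚᴿ q
fromℚ q .im = fromℚᴿ 0ℚ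

private

  +ᴿ-cong : ∀ {x x′ y y′} → x ≈ᴿ x′ → y ≈ᴿ y′ → x +ᴿ y ≈ᴿ x′ +ᴿ y′
  +ᴿ-cong ⟨ p ⟩ ⟨ q ⟩ = ⟨ near-+ p q ⟩

  *ᴿ-cong : ∀ {x x′ y y′} → x ≈ᴿ x′ → y ≈ᴿ y′ → x *ᴿ y ≈ᴿ x′ *ᴿ y′
  *ᴿ-cong {x} {y′ = y′} ⟨ p ⟩ ⟨ q ⟩ = ⟨ near-* (bounded x) (bounded y′) p q ⟩

  -ᴿ-cong : ∀ {x x′} → x ≈ᴿ x′ → -ᴿ x ≈ᴿ -ᴿ x′
  -ᴿ-cong ⟨ p ⟩ = ⟨ near-neg p ⟩

  symᴿ : ∀ {x y} → x ≈ᴿ y → y ≈ᴿ x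
  symᴿ ⟨ p ⟩ = ⟨ near-sym p ⟩

  transᴿ : ∀ {x y z} → x ≈ᴿ y → y ≈ᴿ z → x ≈ᴿ z
  transᴿ ⟨ p ⟩ ⟨ q ⟩ = ⟨ near-trans p q ⟩

  *ᶜ-cong : ∀ {z z′ w w′} → z ≈ᶜ z′ → w ≈ᶜ w′ → z *ᶜ w ≈ᶜ z′ *ᶜ w′
  *ᶜ-cong (p , q) (r , s) =
      +ᴿ-cong (*ᴿ-cong p r) (-ᴿ-cong (*ᴿ-cong q s))
    , +ᴿ-cong (*ᴿ-cong p s) (*ᴿ-cong q r)

  termwise : (z w : ℂ) → (∀ n → seq (re z) n ≡ seq (re w) n) →
             (∀ n → seq (im z) n ≡ seq (im w) n) → z ≈ᶜ w
  termwise z w p q = pointwise (re z) (re w) p , pointwise (im z) (im w) q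

  module Laws where
    open +-*-Solver

    *-assoc : ∀ u z w → (u *ᶜ z) *ᶜ w ≈ᶜ u *ᶜ (z *ᶜ w)
    *-assoc u z w = termwise ((u *ᶜ z) *ᶜ w) (u *ᶜ (z *ᶜ w))
      (λ n → solve 6 (λ a b c d e f →
          (a :* c :+ :- (b :* d)) :* e :+ :- ((a :* d :+ b :* c) :* f)
          := a :* (c :* e :+ :- (d :* f)) :+ :- (b :* (c :* f :+ d :* e))) refl
          (seq (re u) n) (seq (im u) n) (seq (re z) n) (seq (im z) n)
          (seq (re w) n) (seq (im w) n))
      (λ n → solve 6 (λ a b c d e f →
          (a :* c :+ :- (b :* d)) :* f :+ (a :* d :+ b :* c) :* e
          := a :* (c :* f :+ d :* e) :+ b :* (c :* e :+ :- (d :* f))) refl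
          (seq (re u) n) (seq (im u) n) (seq (re z) n) (seq (im z) n)
          (seq (re w) n) (seq (im w) n))

    *-comm : ∀ z w → z *ᶜ w ≈ᶜ w *ᶜ z
    *-comm z w = termwise (z *ᶜ w) (w *ᶜ z)
      (λ n → solve 4 (λ a b c d →
          a :* c :+ :- (b :* d) := c :* a :+ :- (d :* b)) refl
          (seq (re z) n) (seq (im z) n) (seq (re w) n) (seq (im w) n))
      (λ n → solve 4 (λ a b c d →
          a :* d :+ b :* c := c :* b :+ d :* a) refl
          (seq (re z) n) (seq (im z) n) (seq (re w) n) (seq (im w) n))

    *-identityˡ : ∀ z → fromℚ 1ℚ *ᶜ z ≈ᶜ z
    *-identityˡ z = termwise (fromℚ 1ℚ *ᶜ z) z
      (λ n → solve 2 (λ a b → con 1ℚ :* a :+ :- (con 0ℚ :* b) := a) refl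
          (seq (re z) n) (seq (im z) n))
      (λ n → solve 2 (λ a b → con 1ℚ :* b :+ con 0ℚ :* a := b) refl
          (seq (re z) n) (seq (im z) n))

    *-identityʳ : ∀ z → z *ᶜ fromℚ 1ℚ ≈ᶜ z
    *-identityʳ z = termwise (z *ᶜ fromℚ 1ℚ) z
      (λ n → solve 2 (λ a b → a :* con 1ℚ :+ :- (b :* con 0ℚ) := a) refl
          (seq (re z) n) (seq (im z) n))
      (λ n → solve 2 (λ a b → a :* con 0ℚ :+ b :* con 1ℚ := b) refl
          (seq (re z) n) (seq (im z) n))

    distribˡ : ∀ u z w → u *ᶜ (z +ᶜ w) ≈ᶜ u *ᶜ z +ᶜ u *ᶜ w
    distribˡ u z w = termwise (u *ᶜ (z +ᶜ w)) (u *ᶜ z +ᶜ u *ᶜ w)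
      (λ n → solve 6 (λ a b c d e f →
          a :* (c :+ e) :+ :- (b :* (d :+ f))
          := (a :* c :+ :- (b :* d)) :+ (a :* e :+ :- (b :* f))) refl
          (seq (re u) n) (seq (im u) n) (seq (re z) n) (seq (im z) n)
          (seq (re w) n) (seq (im w) n))
      (λ n → solve 6 (λ a b c d e f →
          a :* (d :+ f) :+ b :* (c :+ e)
          := (a :* d :+ b :* c) :+ (a :* f :+ b :* e)) refl
          (seq (re u) n) (seq (im u) n) (seq (re z) n) (seq (im z) n)
          (seq (re w) n) (seq (im w) n))

    distribʳ : ∀ u z w → (z +ᶜ w) *ᶜ u ≈ᶜ z *ᶜ u +ᶜ w *ᶜ u
    distribʳ u z w = termwise ((z +ᶜ w) *ᶜ u) (z *ᶜ u +ᶜ w *ᶜ u)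
      (λ n → solve 6 (λ a b c d e f →
          (c :+ e) :* a :+ :- ((d :+ f) :* b)
          := (c :* a :+ :- (d :* b)) :+ (e :* a :+ :- (f :* b))) refl
          (seq (re u) n) (seq (im u) n) (seq (re z) n) (seq (im z) n)
          (seq (re w) n) (seq (im w) n))
      (λ n → solve 6 (λ a b c d e f →
          (c :+ e) :* b :+ (d :+ f) :* a
          := (c :* b :+ d :* a) :+ (e :* b :+ f :* a)) refl
          (seq (re u) n) (seq (im u) n) (seq (re z) n) (seq (im z) n)
          (seq (re w) n) (seq (im w) n))

ℂ-commutativeRing : CommutativeRing 0ℓ 0ℓ
ℂ-commutativeRing = record
  { Carrier = ℂ
  ; _≈_ = _≈ᶜ_
  ; _+_ = _+ᶜ_
  ; _*_ = _*ᶜ_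
  ; -_  = -ᶜ_
  ; 0#  = fromℚ 0ℚ
  ; 1#  = fromℚ 1ℚ
  ; isCommutativeRing = record
    { isRing = record
      { +-isAbelianGroup = record
        { isGroup = record
          { isMonoid = record
            { isSemigroup = record
              { isMagma = record
                { isEquivalence = record
                  { refl  = λ {z} → ⟨ cauchy (re z) ⟩ , ⟨ cauchy (im z) ⟩
                  ; sym   = λ (p , q) → symᴿ p , symᴿ q
                  ; trans = λ (p , q) (r , s) → transᴿ p r , transᴿ q s
                  }
                ; ∙-cong = λ (p , q) (r , s) → +ᴿ-cong p r , +ᴿ-cong q s
                }
              ; assoc = λ u z w → termwise ((u +ᶜ z) +ᶜ w) (u +ᶜ (z +ᶜ w))
                  (λ n → ℚ.+-assoc (seq (re u) n) (seq (re z) n) (seq (re w) n))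
                  (λ n → ℚ.+-assoc (seq (im u) n) (seq (im z) n) (seq (im w) n))
              }
            ; identity =
                (λ z → termwise (fromℚ 0ℚ +ᶜ z) z
                  (λ n → ℚ.+-identityˡ (seq (re z) n)) (λ n → ℚ.+-identityˡ (seq (im z) n)))
              , (λ z → termwise (z +ᶜ fromℚ 0ℚ) z
                  (λ n → ℚ.+-identityʳ (seq (re z) n)) (λ n → ℚ.+-identityʳ (seq (im z) n)))
            }
          ; inverse =
              (λ z → termwise (-ᶜ z +ᶜ z) (fromℚ 0ℚ)
                (λ n → ℚ.+-inverseˡ (seq (re z) n)) (λ n → ℚ.+-inverseˡ (seq (im z) n)))
            , (λ z → termwise (z +ᶜ -ᶜ z) (fromℚ 0ℚ)
                (λ n → ℚ.+-inverseʳ (seq (re z) n)) (λ n → ℚ.+-inverseʳ (seq (im z) n)))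
          ; ⁻¹-cong = λ (p , q) → -ᴿ-cong p , -ᴿ-cong q
          }
        ; comm = λ z w → termwise (z +ᶜ w) (w +ᶜ z)
            (λ n → ℚ.+-comm (seq (re z) n) (seq (re w) n))
            (λ n → ℚ.+-comm (seq (im z) n) (seq (im w) n))
        }
      ; *-cong = *ᶜ-cong
      ; *-assoc = Laws.*-assoc
      ; *-identity = Laws.*-identityˡ , Laws.*-identityʳ
      ; distrib = Laws.distribˡ , Laws.distribʳ
      }
    ; *-comm = Laws.*-comm
    }
  }

module FormalPowerSeries {c ℓ} (R : CommutativeRing c ℓ) where

  open CommutativeRing R hiding (refl; sym; trans)
  open Algebra.Definitions _≈_ using (Invertible)
  open Algebra.Definitions.RawMonoid +-rawMonoid using (sum)
  private
    module ≈ = CommutativeRing R using (refl; sym; trans)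
    open Algebra.Properties.Ring ring using (-‿distribˡ-*; -‿distribʳ-*; -‿involutive)
    open Algebra.Properties.CommutativeSemigroup *-commutativeSemigroup using (interchange)

  -- The coefficient of xⁿ in p is p n.

  Series : Set c
  Series = ℕ → Carrier

  infixl 6 _+ₛ_ _-ₛ_
  infixl 7 _*ₛ_ _/ₛ_
  infix  8 -ₛ_
  infixr 9 _^ₛ_ _∘ₛ_

  const : Carrier → Series
  const a zero    = a
  const a (suc n) = 0#

  1ₛ : Series
  1ₛ = const 1#

  x : Series
  x zero          = 0#
  x (suc zero)    = 1#
  x (suc (suc n)) = 0#

  _+ₛ_ : Series → Series → Series
  (p +ₛ q) n = p n + q n

  -ₛ_ : Series → Series
  (-ₛ p) n = - p n

  _-ₛ_ : Series → Series → Series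
  p -ₛ q = p +ₛ -ₛ q

  _*ₛ_ : Series → Series → Series
  (p *ₛ q) n = sum {suc n} λ i → p (toℕ i) * q (n ℕ.∸ toℕ i)

  _^ₛ_ : Series → ℕ → Series
  p ^ₛ zero  = 1ₛ
  p ^ₛ suc k = p *ₛ p ^ₛ k

  -- The substitution u(f(x)), meaningful when f has zero constant term:
  -- then fᵏ does not contribute to the coefficient of xⁿ for k > n.

  _∘ₛ_ : Series → Series → Series
  (u ∘ₛ f) n = sum {suc n} λ k → u (toℕ k) * (f ^ₛ toℕ k) n

  -- The quotient p/q, meaningful when q has constant term 1:
  -- 1/q is the geometric series 1 + y + y² + ⋯ at y = 1 - q.

  _/ₛ_ : Series → Series → Series
  p /ₛ q = p *ₛ ((λ _ → 1#) ∘ₛ (1ₛ -ₛ q))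

  -- Nonvanishing of f₁ is read as invertibility, its constructive form in
  -- a field.

  record RiordanArray : Set (c ⊔ ℓ) where
    field
      g f   : Series
      g₀≈1  : g 0 ≈ 1#
      f₀≈0  : f 0 ≈ 0#
      f₁-inv : Invertible 1# _*_ (f 1)

    entry : ℕ → ℕ → Carrier
    entry n k = (g *ₛ f ^ₛ k) n

  open RiordanArray

  infix 4 _≈ʳ_

  _≈ʳ_ : RiordanArray → RiordanArray → Set ℓ
  S ≈ʳ T = ∀ n k → entry S n k ≈ entry T n k

  identityArray : RiordanArray
  identityArray = record
    { g = 1ₛ ; f = x ; g₀≈1 = ≈.refl ; f₀≈0 = ≈.refl
    ; f₁-inv = 1# , *-identityˡ 1# , *-identityˡ 1#
    }

  infixl 7 _·_

  _·_ : RiordanArray → RiordanArray → RiordanArray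
  S · T = record
    { g = g S *ₛ (g T ∘ₛ f S)
    ; f = f T ∘ₛ f S
    ; g₀≈1 = begin
        g S 0 * (g T 0 * 1# + 0#) + 0#  ≈⟨ +-identityʳ _ ⟩
        g S 0 * (g T 0 * 1# + 0#)       ≈⟨ *-cong (g₀≈1 S) (single (g T 0)) ⟩
        1# * g T 0                      ≈⟨ *-identityˡ _ ⟩
        g T 0                           ≈⟨ g₀≈1 T ⟩
        1#                              ∎
    ; f₀≈0 = ≈.trans (single (f T 0)) (f₀≈0 T)
    ; f₁-inv = inv (f₁-inv S) (f₁-inv T)
    }
    where
    open Relation.Binary.Reasoning.Setoid setoid
    single : ∀ a → a * 1# + 0# ≈ a
    single a = ≈.trans (+-identityʳ _) (*-identityʳ a)
    drop : ∀ a b → a * 0# + b ≈ b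
    drop a b = ≈.trans (+-congʳ (zeroʳ a)) (+-identityˡ b)
    coeff₁ : (f T ∘ₛ f S) 1 ≈ f T 1 * f S 1
    coeff₁ = begin
      f T 0 * 0# + (f T 1 * (f S 0 * 0# + (f S 1 * 1# + 0#)) + 0#)
        ≈⟨ drop _ _ ⟩
      f T 1 * (f S 0 * 0# + (f S 1 * 1# + 0#)) + 0#
        ≈⟨ +-identityʳ _ ⟩
      f T 1 * (f S 0 * 0# + (f S 1 * 1# + 0#))
        ≈⟨ *-congˡ (≈.trans (drop _ _) (single _)) ⟩
      f T 1 * f S 1  ∎
    inv : Invertible 1# _*_ (f S 1) → Invertible 1# _*_ (f T 1) →
          Invertible 1# _*_ ((f T ∘ₛ f S) 1)
    inv (a , aS≈1 , _) (b , bT≈1 , _) = b * a , left , ≈.trans (*-comm _ _) left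
      where
      left : (b * a) * (f T ∘ₛ f S) 1 ≈ 1#
      left = begin
        (b * a) * (f T ∘ₛ f S) 1    ≈⟨ *-congˡ coeff₁ ⟩
        (b * a) * (f T 1 * f S 1)   ≈⟨ interchange b a (f T 1) (f S 1) ⟩
        (b * f T 1) * (a * f S 1)   ≈⟨ *-cong bT≈1 aS≈1 ⟩
        1# * 1#                     ≈⟨ *-identityˡ 1# ⟩
        1#                          ∎

  signedBell : (g : Series) → g 0 ≈ 1# → RiordanArray
  signedBell g g₀≈1 = record
    { g = g
    ; f = -ₛ (x *ₛ g)
    ; g₀≈1 = g₀≈1
    ; f₀≈0 = begin
        - (0# * g 0 + 0#)  ≈⟨ -‿cong (≈.trans (+-identityʳ _) (zeroˡ _)) ⟩
        - 0#               ≈⟨ ≈.sym (+-identityˡ _) ⟩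
        0# + - 0#          ≈⟨ -‿inverseʳ 0# ⟩
        0#                 ∎
    ; f₁-inv = - 1# , left , ≈.trans (*-comm _ _) left
    }
    where
    open Relation.Binary.Reasoning.Setoid setoid
    coeff₁ : (x *ₛ g) 1 ≈ 1#
    coeff₁ = begin
      0# * g 1 + (1# * g 0 + 0#)  ≈⟨ +-congʳ (zeroˡ _) ⟩
      0# + (1# * g 0 + 0#)        ≈⟨ +-identityˡ _ ⟩
      1# * g 0 + 0#               ≈⟨ +-identityʳ _ ⟩
      1# * g 0                    ≈⟨ *-identityˡ _ ⟩
      g 0                         ≈⟨ g₀≈1 ⟩
      1#                          ∎
    left : - 1# * (-ₛ (x *ₛ g)) 1 ≈ 1#
    left = begin
      - 1# * - (x *ₛ g) 1    ≈⟨ *-congˡ (-‿cong coeff₁) ⟩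
      - 1# * - 1#            ≈⟨ ≈.sym (-‿distribˡ-* 1# (- 1#)) ⟩
      - (1# * - 1#)          ≈⟨ -‿cong (*-identityˡ _) ⟩
      - - 1#                 ≈⟨ -‿involutive 1# ⟩
      1#                     ∎

  Involutory : Series → Set ℓ
  Involutory g = ∃ λ (g₀≈1 : g 0 ≈ 1#) →
    signedBell g g₀≈1 · signedBell g g₀≈1 ≈ʳ identityArray

open FormalPowerSeries ℂ-commutativeRing public

catalan : Series
catalan n = fromℚ (+ ((2 ℕ.* n) C n) ℚ./ suc n)

gSeries : (a b c : ℂ) → Series
gSeries a b c =
  (1ₛ /ₛ d) *ₛ
  (catalan ∘ₛ (-ₛ (x ^ₛ 2 *ₛ (const b +ₛ const c *ₛ x)) /ₛ d ^ₛ 2))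
  where
  d : Series
  d = 1ₛ -ₛ const a *ₛ x -ₛ const b *ₛ x ^ₛ 2

module Submission where

-- Write d = 1 - ax - bx² and s = x²(b + cx).  As C = 1 + x C², the series g
-- solves g + s g² = 1 + (ax + bx²) g.  Let y = -x g and h = g(y); then
-- (g, y)² = (g h, x g h), so the claim is g h = 1.  Substituting y in the
-- equation of g and multiplying by g gives an equation for E = g h,
--   E + (A E + B E²) = g + (K E² + G E),
-- with A = axg, B = bx²g, K = cx³g², G = bx²g², and E = 1 also solves it: this
-- is again the equation of g.  As A, B, K, G have no constant term, the
-- coefficients of E are determined one after the other, hence g h = 1.

open import Algebra.Bundles using (CommutativeRing)
import Algebra.Definitions.RawMonoid
import Algebra.Properties.Ring
import Algebra.Properties.Semiring.Mult
import Algebra.Solver.Ring.NaturalCoefficients.Default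
open import Data.Fin.Base using (toℕ)
open import Data.Integer.Base as ℤ using (+_)
import Data.Integer.Properties as ℤ
import Data.Integer.Tactic.RingSolver as ℤ-Solver
open import Data.Nat.Base as ℕ using (ℕ; zero; suc; _<_; z<s; s<s; _!)
import Data.Nat.DivMod as ℕ
import Data.Nat.Properties as ℕ
import Data.Nat.Tactic.RingSolver as ℕ-Solver
open import Data.Product.Base using (_,_)
open import Data.Rational.Base as ℚ using (0ℚ; 1ℚ; toℚᵘ)
import Data.Rational.Properties as ℚ
open import Data.Rational.Unnormalised.Base as ℚᵘ using (mkℚᵘ; *≡*)
import Data.Rational.Unnormalised.Properties as ℚᵘ
open import Defs using (module FormalPowerSeries)
open import Relation.Binary.PropositionalEquality as ≡ using (_≡_)
import Relation.Binary.Reasoning.Setoid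

-- Identities in an arbitrary commutative ring, later applied to series.

module RingIdentities {c ℓ} (R : CommutativeRing c ℓ) where

  open CommutativeRing R
  open Algebra.Properties.Ring ring
  open Algebra.Solver.Ring.NaturalCoefficients.Default commutativeSemiring
    using (solve; _:=_; _:+_; _:*_; con)
  open Relation.Binary.Reasoning.Setoid setoid

  -- Adding `(1# - q) * G` to `q * G` gives `G`, so the hypothesis and cancellation suffice. `G`
  -- will be the geometric series in `1# - q`.
  geometric : ∀ q G → G ≈ 1# + (1# - q) * G → q * G ≈ 1#
  geometric q G G≈ = +-cancelʳ ((1# - q) * G) (q * G) 1# (begin
    q * G + (1# - q) * G   ≈⟨ distribʳ G q (1# - q) ⟨
    (q + (1# - q)) * G     ≈⟨ *-congʳ (trans (+-comm q (1# - q)) (//-rightDividesˡ q 1#)) ⟩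
    1# * G                 ≈⟨ *-identityˡ G ⟩
    G                      ≈⟨ G≈ ⟩
    1# + (1# - q) * G      ∎)

  -- `J` and `I` stand for the reciprocals of `d` and `d²`, and `T` for the Catalan series at
  -- `- s / d²`. From `d * g = T` follows `g = T + (q + p) * g`; from `J * J = I` follows
  -- `s * g² = s * I * T²`, which the equation of `T` turns into `1 - T`. In the sum `T` cancels.
  bell-equation : ∀ p q s {J I T} → let d = 1# - p - q; g = (1# * J) * T in
    d * J ≈ 1# → (d * (d * 1#)) * I ≈ 1# → T ≈ 1# + ((- s) * I) * (T * T) →
    g + s * (g * g) ≈ 1# + (q + p) * g
  bell-equation p q s {J} {I} {T} dJ≈1 d²I≈1 T≈ = begin
    g + s * (g * g)
      ≈⟨ +-cong g≈ (*-congˡ g²≈) ⟩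
    (T + (q + p) * g) + s * (I * (T * T))
      ≈⟨ solve 3 (λ t e s → (t :+ e) :+ s := (t :+ s) :+ e) refl T ((q + p) * g) _ ⟩
    (T + s * (I * (T * T))) + (q + p) * g
      ≈⟨ +-congʳ T+ ⟩
    1# + (q + p) * g  ∎
    where
    d = 1# - p - q
    g = (1# * J) * T
    d+ : d + (q + p) ≈ 1#
    d+ = begin
      d + (q + p)     ≈⟨ +-assoc d q p ⟨
      (d + q) + p     ≈⟨ +-congʳ (//-rightDividesˡ q (1# - p)) ⟩
      (1# - p) + p    ≈⟨ //-rightDividesˡ p 1# ⟩
      1#              ∎
    g≈ : g ≈ T + (q + p) * g
    g≈ = begin
      g                          ≈⟨ *-identityˡ g ⟨
      1# * g                     ≈⟨ *-congʳ d+ ⟨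
      (d + (q + p)) * g          ≈⟨ solve 4 (λ d e J T →
                                      (d :+ e) :* ((con 1 :* J) :* T) :=
                                      (d :* J) :* T :+ e :* ((con 1 :* J) :* T))
                                      refl d (q + p) J T ⟩
      (d * J) * T + (q + p) * g  ≈⟨ +-congʳ (trans (*-congʳ dJ≈1) (*-identityˡ T)) ⟩
      T + (q + p) * g            ∎
    J²≈I : J * J ≈ I
    J²≈I = begin
      J * J                             ≈⟨ *-identityʳ (J * J) ⟨
      (J * J) * 1#                      ≈⟨ *-congˡ d²I≈1 ⟨
      (J * J) * ((d * (d * 1#)) * I)    ≈⟨ solve 3 (λ d J I →
                                             (J :* J) :* ((d :* (d :* con 1)) :* I) :=
                                             ((d :* J) :* (d :* J)) :* I) refl d J I ⟩
      ((d * J) * (d * J)) * I           ≈⟨ *-congʳ (*-cong dJ≈1 dJ≈1) ⟩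
      (1# * 1#) * I                     ≈⟨ solve 1 (λ I → (con 1 :* con 1) :* I := I) refl I ⟩
      I                                 ∎
    g²≈ : g * g ≈ I * (T * T)
    g²≈ = trans
      (solve 2 (λ J T → ((con 1 :* J) :* T) :* ((con 1 :* J) :* T) := (J :* J) :* (T :* T))
        refl J T)
      (*-congʳ J²≈I)
    T+ : T + s * (I * (T * T)) ≈ 1#
    T+ = begin
      T + s * (I * (T * T))
        ≈⟨ +-congʳ T≈ ⟩
      (1# + ((- s) * I) * (T * T)) + s * (I * (T * T))
        ≈⟨ solve 4 (λ m s I t →
             (con 1 :+ (m :* I) :* t) :+ s :* (I :* t) := con 1 :+ (m :+ s) :* (I :* t))
             refl (- s) s I (T * T) ⟩
      1# + (- s + s) * (I * (T * T))
        ≈⟨ +-congˡ (trans (*-congʳ (-‿inverseˡ s)) (zeroˡ _)) ⟩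
      1# + 0#
        ≈⟨ +-identityʳ 1# ⟩
      1#  ∎

  -- The left side is what `y ∘ₛ y` becomes for `y = - (x * g)` and `h = g(y)`.
  reflected-product : ∀ x g h → g * h ≈ 1# → - (- (x * g) * h) ≈ x
  reflected-product x g h gh≈1 = begin
    - (- (x * g) * h)    ≈⟨ -‿cong (-‿distribˡ-* (x * g) h) ⟨
    - - (x * g * h)      ≈⟨ -‿involutive _ ⟩
    x * g * h            ≈⟨ *-assoc x g h ⟩
    x * (g * h)          ≈⟨ *-congˡ gh≈1 ⟩
    x * 1#               ≈⟨ *-identityʳ x ⟩
    x                    ∎

  module _ (a b c x g : Carrier) where

    private
      -- The factors `x` stand outermost so that `x*-coeff₀` yields the vanishing constant terms at
      -- once.
      x² A B K G : Carrier
      x² = x * (x * 1#)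
      A = x * (a * g)
      B = x * (x * (b * g))
      K = x * (x * (x * (c * (g * g))))
      G = x * (x * (b * (g * g)))

    quadratic-at-1 :
      g + (x² * (b + c * x)) * (g * g) ≈ 1# + (b * x² + a * x) * g →
      1# + (A * 1# + B * (1# * 1#)) ≈ g + (K * (1# * 1#) + G * 1#)
    quadratic-at-1 g-eq = begin
      1# + (A * 1# + B * (1# * 1#))
        ≈⟨ solve 4 (λ a b x g →
             con 1 :+ (x :* (a :* g) :* con 1 :+ x :* (x :* (b :* g)) :* (con 1 :* con 1)) :=
             con 1 :+ (b :* (x :* (x :* con 1)) :+ a :* x) :* g) refl a b x g ⟩
      1# + (b * x² + a * x) * g
        ≈⟨ g-eq ⟨
      g + (x² * (b + c * x)) * (g * g)
        ≈⟨ solve 4 (λ b c x g →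
             g :+ ((x :* (x :* con 1)) :* (b :+ c :* x)) :* (g :* g) :=
             g :+ (x :* (x :* (x :* (c :* (g :* g)))) :* (con 1 :* con 1) :+
                   x :* (x :* (b :* (g :* g))) :* con 1)) refl b c x g ⟩
      g + (K * (1# * 1#) + G * 1#)  ∎

    -- Multiply the hypothesis by `g` and put `w = x * g`. As `y² = w²`, the terms in `b` stay on
    -- their sides and give `B` and `G`. The terms odd in `y` change sign with `y = - w` and cross
    -- over: the one in `a` gives `A` on the left, the one in `c` gives `K` on the right.
    quadratic-at-product : ∀ h → let y = - (x * g); y² = y * (y * 1#); E = g * h in
      h + (y² * (b + c * y)) * (h * h) ≈ 1# + (b * y² + a * y) * h →
      E + (A * E + B * (E * E)) ≈ g + (K * (E * E) + G * E)
    -- To the solver `y` is an independent variable. So the odd terms are not moved across: their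
    -- sum `M` is added on both sides, and `vanish` exchanges one multiple of `y + w`, which is
    -- zero, for another.
    quadratic-at-product h h-eq = +-cancelʳ M _ _ (begin
      E + (A * E + B * (E * E)) + M
        ≈⟨ solve 7 (λ a b c x g h y →
             let E = g :* h; w = x :* g in
             E :+ (x :* (a :* g) :* E :+ x :* (x :* (b :* g)) :* (E :* E)) :+
               (c :* (w :* w) :* (h :* h) :* g :* y :+ a :* h :* g :* y) :=
             g :* (h :+ (w :* w) :* (b :+ c :* y) :* (h :* h)) :+ a :* h :* g :* (y :+ w))
             refl a b c x g h y ⟩
      g * (h + (w * w) * (b + c * y) * (h * h)) + a * h * g * (y + w)
        ≈⟨ +-cong (*-congˡ h-eq′) (vanish (a * h * g) (c * (w * w) * (h * h) * g)) ⟩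
      g * (1# + (b * (w * w) + a * y) * h) + c * (w * w) * (h * h) * g * (y + w)
        ≈⟨ solve 7 (λ a b c x g h y →
             let E = g :* h; w = x :* g in
             g :* (con 1 :+ (b :* (w :* w) :+ a :* y) :* h) :+
               c :* (w :* w) :* (h :* h) :* g :* (y :+ w) :=
             g :+ (x :* (x :* (x :* (c :* (g :* g)))) :* (E :* E) :+
                   x :* (x :* (b :* (g :* g))) :* E) :+
               (c :* (w :* w) :* (h :* h) :* g :* y :+ a :* h :* g :* y))
             refl a b c x g h y ⟩
      g + (K * (E * E) + G * E) + M  ∎)
      where
      w = x * g
      y = - w
      E = g * h
      M = c * (w * w) * (h * h) * g * y + a * h * g * y
      vanish : ∀ s t → s * (y + w) ≈ t * (y + w)
      vanish s t = trans (trans (*-congˡ (-‿inverseˡ w)) (zeroʳ s))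
                    (sym (trans (*-congˡ (-‿inverseˡ w)) (zeroʳ t)))
      y²≈w² : y * (y * 1#) ≈ w * w
      y²≈w² = begin
        y * (y * 1#)    ≈⟨ *-congˡ (*-identityʳ y) ⟩
        - w * - w       ≈⟨ -‿distribˡ-* w (- w) ⟨
        - (w * - w)     ≈⟨ -‿cong (-‿distribʳ-* w w) ⟨
        - - (w * w)     ≈⟨ -‿involutive (w * w) ⟩
        w * w           ∎
      h-eq′ : h + (w * w) * (b + c * y) * (h * h) ≈ 1# + (b * (w * w) + a * y) * h
      h-eq′ = begin
        h + (w * w) * (b + c * y) * (h * h)
          ≈⟨ +-congˡ (*-congʳ (*-congʳ y²≈w²)) ⟨
        h + (y * (y * 1#)) * (b + c * y) * (h * h)
          ≈⟨ h-eq ⟩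
        1# + (b * (y * (y * 1#)) + a * y) * h
          ≈⟨ +-congˡ (*-congʳ (+-congʳ (*-congˡ y²≈w²))) ⟩
        1# + (b * (w * w) + a * y) * h  ∎

  module _ (x C C′ Q Q′ : Carrier) where

    private
      four : Carrier → Carrier
      four t = (t + t) + (t + t)

    -- With ′ standing for x d/dx, this is (1 - 4x) F′ = -F for F = Q - C,
    -- rearranged so that no subtraction occurs; its only solution is F = 0.
    catalan-ode :
      C + C′ ≈ 1# + x * (four C′ + (C + C)) →
      Q ≈ 1# + x * (C * C) →
      Q′ ≈ x * (C * C) + x * (C′ * C + C * C′) →
      (Q + Q′) + x * four C′ ≈ (C + C′) + x * four Q′
    catalan-ode C-eq Q≈ Q′≈ = begin
      (Q + Q′) + x * four C′
        ≈⟨ +-congʳ (+-cong Q≈ Q′≈) ⟩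
      ((1# + x * (C * C)) + (x * (C * C) + x * (C′ * C + C * C′))) + x * four C′
        ≈⟨ solve 3 (λ x C D →
             ((con 1 :+ x :* (C :* C)) :+ (x :* (C :* C) :+ x :* (D :* C :+ C :* D)))
               :+ x :* ((D :+ D) :+ (D :+ D)) :=
             con 1 :+ x :* ((D :+ D) :+ (D :+ D)) :+ con 2 :* x :* C :* (C :+ D))
             refl x C C′ ⟩
      1# + x * four C′ + (1# + 1#) * x * C * (C + C′)
        ≈⟨ +-congˡ (*-congˡ C-eq) ⟩
      1# + x * four C′ + (1# + 1#) * x * C * (1# + x * (four C′ + (C + C)))
        ≈⟨ solve 3 (λ x C D →
             con 1 :+ x :* ((D :+ D) :+ (D :+ D)) :+ con 2 :* x :* C :*
               (con 1 :+ x :* (((D :+ D) :+ (D :+ D)) :+ (C :+ C))) :=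
             (con 1 :+ x :* (((D :+ D) :+ (D :+ D)) :+ (C :+ C))) :+
               x :* (let t = x :* (C :* C) :+ x :* (D :* C :+ C :* D) in (t :+ t) :+ (t :+ t)))
             refl x C C′ ⟩
      (1# + x * (four C′ + (C + C))) + x * four (x * (C * C) + x * (C′ * C + C * C′))
        ≈⟨ +-cong C-eq (*-congˡ (+-cong (+-cong Q′≈ Q′≈) (+-cong Q′≈ Q′≈))) ⟨
      (C + C′) + x * four Q′  ∎

-- The commutative ring of formal power series.

module PowerSeries {c ℓ} (R : CommutativeRing c ℓ) where

  open CommutativeRing R
  open FormalPowerSeries R
  open Algebra.Definitions.RawMonoid +-rawMonoid using (sum)
  open Algebra.Properties.Semiring.Mult semiring
  open Algebra.Solver.Ring.NaturalCoefficients.Default commutativeSemiring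
    using (solve; _:=_; _:+_; _:*_; con)
  open Relation.Binary.Reasoning.Setoid setoid

  private module Rₚ = Algebra.Properties.Ring ring

  infix  4 _≋_ _≈[<_]_
  infixl 7 _•_

  record _≋_ (p q : Series) : Set ℓ where
    constructor coeffwise
    field coeff : ∀ n → p n ≈ q n

  open _≋_ public

  -- Congruence modulo `xⁿ`, the form of the induction hypotheses on coefficients.
  _≈[<_]_ : Series → ℕ → Series → Set ℓ
  p ≈[< n ] q = ∀ i → i < n → p i ≈ q i

  -- This is `(p - p 0) / x`. By computation `(p *ₛ q) (suc n)` is
  -- `p 0 * q (suc n) + (tail p *ₛ q) n`, so proofs about products go by induction on `n` with the
  -- left factor generalised.
  tail : Series → Series
  tail p n = p (suc n)

  0ₛ : Series
  0ₛ _ = 0#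

  _•_ : Carrier → Series → Series
  (a • p) n = a * p n

  *ₛ-coeff₀ : ∀ p q → (p *ₛ q) 0 ≈ p 0 * q 0
  *ₛ-coeff₀ p q = +-identityʳ _

  *ₛ-agree : ∀ n {p p′ q q′} → p ≈[< suc n ] p′ → q ≈[< suc n ] q′ →
             (p *ₛ q) n ≈ (p′ *ₛ q′) n
  *ₛ-agree zero    p≈ q≈ = +-congʳ (*-cong (p≈ 0 z<s) (q≈ 0 z<s))
  *ₛ-agree (suc n) {p} {p′} p≈ q≈ = +-cong
    (*-cong (p≈ 0 z<s) (q≈ (suc n) (ℕ.n<1+n (suc n))))
    (*ₛ-agree n {tail p} {tail p′} (λ i i<n → p≈ (suc i) (s<s i<n))
      (λ i i<n → q≈ i (ℕ.m<n⇒m<1+n i<n)))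

  -- Without a constant term in p, the coefficient of xⁿ in p q involves
  -- only the coefficients of q below n.
  *ₛ-contract : ∀ n {p q q′} → p 0 ≈ 0# → q ≈[< n ] q′ → (p *ₛ q) n ≈ (p *ₛ q′) n
  *ₛ-contract n {p} {q} {q′} p₀≈0 q≈ = go n q≈
    where
    vanish : ∀ a b → p 0 * a ≈ p 0 * b
    vanish a b = trans (trans (*-congʳ p₀≈0) (zeroˡ a))
                       (sym (trans (*-congʳ p₀≈0) (zeroˡ b)))
    go : ∀ n → q ≈[< n ] q′ → (p *ₛ q) n ≈ (p *ₛ q′) n
    go zero    _  = +-congʳ (vanish (q 0) (q′ 0))
    go (suc n) q≈ = +-cong (vanish (q (suc n)) (q′ (suc n)))
      (*ₛ-agree n {tail p} (λ _ _ → refl) q≈)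

  *ₛ-cong : ∀ {p p′ q q′} → p ≋ p′ → q ≋ q′ → p *ₛ q ≋ p′ *ₛ q′
  *ₛ-cong p≈ q≈ .coeff n = *ₛ-agree n (λ i _ → coeff p≈ i) (λ i _ → coeff q≈ i)

  *ₛ-zeroˡ : ∀ p → 0ₛ *ₛ p ≋ 0ₛ
  *ₛ-zeroˡ p .coeff = go
    where
    go : ∀ n → (0ₛ *ₛ p) n ≈ 0#
    go zero    = trans (+-identityʳ _) (zeroˡ _)
    go (suc n) = trans (+-cong (zeroˡ _) (go n)) (+-identityʳ 0#)

  *ₛ-distribʳ : ∀ r p q → (p +ₛ q) *ₛ r ≋ p *ₛ r +ₛ q *ₛ r
  *ₛ-distribʳ r p q .coeff n = go n p q
    where
    go : ∀ n p q → ((p +ₛ q) *ₛ r) n ≈ (p *ₛ r) n + (q *ₛ r) n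
    go zero    p q = solve 3 (λ a b c →
        (a :+ b) :* c :+ con 0 := (a :* c :+ con 0) :+ (b :* c :+ con 0)) refl
        (p 0) (q 0) (r 0)
    go (suc n) p q = trans (+-congˡ (go n (tail p) (tail q)))
      (solve 5 (λ a b c u v →
        (a :+ b) :* c :+ (u :+ v) := (a :* c :+ u) :+ (b :* c :+ v)) refl
        (p 0) (q 0) (r (suc n)) ((tail p *ₛ r) n) ((tail q *ₛ r) n))

  *ₛ-•ˡ : ∀ a p q → (a • p) *ₛ q ≋ a • (p *ₛ q)
  *ₛ-•ˡ a p q .coeff n = go n p
    where
    go : ∀ n p → ((a • p) *ₛ q) n ≈ a * (p *ₛ q) n
    go zero    p = solve 3 (λ a b c →
        a :* b :* c :+ con 0 := a :* (b :* c :+ con 0)) refl a (p 0) (q 0)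
    go (suc n) p = trans (+-congˡ (go n (tail p)))
      (solve 4 (λ a b c u → a :* b :* c :+ a :* u := a :* (b :* c :+ u)) refl
        a (p 0) (q (suc n)) ((tail p *ₛ q) n))

  *ₛ-assoc : ∀ p q r → (p *ₛ q) *ₛ r ≋ p *ₛ (q *ₛ r)
  *ₛ-assoc p q r .coeff n = go n p
    where
    go : ∀ n p → ((p *ₛ q) *ₛ r) n ≈ (p *ₛ (q *ₛ r)) n
    go zero    p = solve 3 (λ a b c →
        (a :* b :+ con 0) :* c :+ con 0 := a :* (b :* c :+ con 0) :+ con 0) refl
        (p 0) (q 0) (r 0)
    go (suc n) p = begin
      -- The tail of `p *ₛ q` has unfolded to `p 0 • tail q +ₛ tail p *ₛ q`.
      (p 0 * q 0 + 0#) * r (suc n) + ((p 0 • tail q +ₛ tail p *ₛ q) *ₛ r) n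
        ≈⟨ +-congˡ (coeff (*ₛ-distribʳ r (p 0 • tail q) (tail p *ₛ q)) n) ⟩
      (p 0 * q 0 + 0#) * r (suc n) + (((p 0 • tail q) *ₛ r) n + ((tail p *ₛ q) *ₛ r) n)
        ≈⟨ +-congˡ (+-cong (coeff (*ₛ-•ˡ (p 0) (tail q) r) n) (go n (tail p))) ⟩
      (p 0 * q 0 + 0#) * r (suc n) + (p 0 * (tail q *ₛ r) n + (tail p *ₛ (q *ₛ r)) n)
        ≈⟨ solve 5 (λ a b c u v →
             (a :* b :+ con 0) :* c :+ (a :* u :+ v) := a :* (b :* c :+ u) :+ v) refl
             (p 0) (q 0) (r (suc n)) ((tail q *ₛ r) n) ((tail p *ₛ (q *ₛ r)) n) ⟩
      p 0 * (q 0 * r (suc n) + (tail q *ₛ r) n) + (tail p *ₛ (q *ₛ r)) n  ∎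

  -- The product unfolds from the first coefficient of the left factor; `last` splits off the
  -- opposite end of the sum, which is the same recursion with the factors exchanged.
  *ₛ-comm : ∀ p q → p *ₛ q ≋ q *ₛ p
  *ₛ-comm p q .coeff n = go n p q
    where
    last : ∀ n p q → (p *ₛ q) (suc n) ≈ p (suc n) * q 0 + (p *ₛ tail q) n
    last zero    p q = solve 4 (λ a b c d →
        a :* d :+ (b :* c :+ con 0) := b :* c :+ (a :* d :+ con 0)) refl
        (p 0) (p 1) (q 0) (q 1)
    last (suc n) p q = trans (+-congˡ (last n (tail p) q))
      (solve 3 (λ a b c → a :+ (b :+ c) := b :+ (a :+ c)) refl
        (p 0 * q (suc (suc n))) (p (suc (suc n)) * q 0) ((tail p *ₛ tail q) n))
    go : ∀ n p q → (p *ₛ q) n ≈ (q *ₛ p) n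
    go zero    p q = +-congʳ (*-comm (p 0) (q 0))
    go (suc n) p q = trans (+-cong (*-comm _ _) (go n (tail p) q)) (sym (last n q p))

  *ₛ-identityˡ : ∀ p → 1ₛ *ₛ p ≋ p
  *ₛ-identityˡ p .coeff zero    = trans (+-identityʳ _) (*-identityˡ _)
  *ₛ-identityˡ p .coeff (suc n) =
    trans (+-cong (*-identityˡ _) (coeff (*ₛ-zeroˡ p) n)) (+-identityʳ _)

  seriesRing : CommutativeRing c ℓ
  seriesRing = record
    { Carrier = Series
    ; _≈_ = _≋_
    ; _+_ = _+ₛ_
    ; _*_ = _*ₛ_
    ; -_  = -ₛ_
    ; 0#  = 0ₛ
    ; 1#  = 1ₛ
    ; isCommutativeRing = record
      { isRing = record
        { +-isAbelianGroup = record
          { isGroup = record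
            { isMonoid = record
              { isSemigroup = record
                { isMagma = record
                  { isEquivalence = record
                    { refl  = coeffwise λ _ → refl
                    ; sym   = λ p≈q → coeffwise λ n → sym (coeff p≈q n)
                    ; trans = λ p≈q q≈r → coeffwise λ n → trans (coeff p≈q n) (coeff q≈r n)
                    }
                  ; ∙-cong = λ p≈ q≈ → coeffwise λ n → +-cong (coeff p≈ n) (coeff q≈ n)
                  }
                ; assoc = λ p q r → coeffwise λ n → +-assoc (p n) (q n) (r n)
                }
              ; identity = (λ p → coeffwise λ n → +-identityˡ (p n))
                         , (λ p → coeffwise λ n → +-identityʳ (p n))
              }
            ; inverse = (λ p → coeffwise λ n → -‿inverseˡ (p n))
                      , (λ p → coeffwise λ n → -‿inverseʳ (p n))
            ; ⁻¹-cong = λ p≈ → coeffwise λ n → -‿cong (coeff p≈ n)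
            }
          ; comm = λ p q → coeffwise λ n → +-comm (p n) (q n)
          }
        ; *-cong = *ₛ-cong
        ; *-assoc = *ₛ-assoc
        ; *-identity = *ₛ-identityˡ , λ p → coeffwise λ n →
            trans (coeff (*ₛ-comm p 1ₛ) n) (coeff (*ₛ-identityˡ p) n)
        ; distrib = (λ r p q → coeffwise λ n →
            trans (coeff (*ₛ-comm r (p +ₛ q)) n)
              (trans (coeff (*ₛ-distribʳ r p q) n)
                (+-cong (coeff (*ₛ-comm p r) n) (coeff (*ₛ-comm q r) n))))
          , *ₛ-distribʳ
        }
      ; *-comm = *ₛ-comm
      }
    }

  module S = CommutativeRing seriesRing

  open RingIdentities seriesRing

  const-* : ∀ a p → const a *ₛ p ≋ a • p
  const-* a p .coeff zero    = +-identityʳ _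
  const-* a p .coeff (suc n) = trans (+-congˡ (coeff (*ₛ-zeroˡ p) n)) (+-identityʳ _)

  private module Sₛ = Algebra.Solver.Ring.NaturalCoefficients.Default S.commutativeSemiring

  -- The `+ 0#` is kept because the constant term of a product computes to this form, in which `∘-*`
  -- meets it.
  const-const : ∀ a b → const a *ₛ const b ≋ const (a * b + 0#)
  const-const a b .coeff zero    = refl
  const-const a b .coeff (suc n) =
    trans (coeff (const-* a (const b)) (suc n)) (zeroʳ a)

  tail-x : tail x ≋ 1ₛ
  tail-x .coeff zero    = refl
  tail-x .coeff (suc n) = refl

  x*-coeff₀ : ∀ p → (x *ₛ p) 0 ≈ 0#
  x*-coeff₀ p = trans (+-identityʳ _) (zeroˡ _)

  x*-coeff : ∀ p n → (x *ₛ p) (suc n) ≈ p n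
  x*-coeff p n = begin
    0# * p (suc n) + (tail x *ₛ p) n  ≈⟨ +-congʳ (zeroˡ _) ⟩
    0# + (tail x *ₛ p) n              ≈⟨ +-identityˡ _ ⟩
    (tail x *ₛ p) n                   ≈⟨ coeff (*ₛ-cong tail-x (S.refl {p})) n ⟩
    (1ₛ *ₛ p) n                       ≈⟨ coeff (*ₛ-identityˡ p) n ⟩
    p n                               ∎

  *ₛ-coeff₀≈0 : ∀ p q → p 0 ≈ 0# → (p *ₛ q) 0 ≈ 0#
  *ₛ-coeff₀≈0 p q p₀≈0 = trans (+-identityʳ _) (trans (*-congʳ p₀≈0) (zeroˡ _))

  ^ₛ-cong : ∀ {p q} k → p ≋ q → p ^ₛ k ≋ q ^ₛ k
  ^ₛ-cong zero    p≈q = S.refl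
  ^ₛ-cong (suc k) p≈q = *ₛ-cong p≈q (^ₛ-cong k p≈q)

  -- Substitution of a series without constant term.

  private

    -- `F` is an arbitrary family, not the powers of one series, because the inductions on `N` shift
    -- its index.
    truncated : ℕ → (ℕ → Carrier) → (ℕ → Series) → Series
    truncated N v F n = sum {N} λ k → v (toℕ k) * F (toℕ k) n

    *ₛ-truncated : ∀ N v f F n →
      truncated N v (λ k → f *ₛ F k) n ≈ (f *ₛ truncated N v F) n
    *ₛ-truncated zero    v f F n = sym (coeff (S.zeroʳ f) n)
    *ₛ-truncated (suc N) v f F n = begin
      v 0 * (f *ₛ F 0) n + truncated N (tail v) (λ k → f *ₛ F (suc k)) n
        ≈⟨ +-cong scale (*ₛ-truncated N (tail v) f (λ k → F (suc k)) n) ⟩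
      (f *ₛ (v 0 • F 0)) n + (f *ₛ rest) n
        ≈⟨ coeff (S.distribˡ f (v 0 • F 0) rest) n ⟨
      (f *ₛ (v 0 • F 0 +ₛ rest)) n  ∎
      where
      rest = truncated N (tail v) (λ k → F (suc k))
      scale : v 0 * (f *ₛ F 0) n ≈ (f *ₛ (v 0 • F 0)) n
      scale = begin
        v 0 * (f *ₛ F 0) n      ≈⟨ *-congˡ (coeff (*ₛ-comm f (F 0)) n) ⟩
        v 0 * (F 0 *ₛ f) n      ≈⟨ coeff (*ₛ-•ˡ (v 0) (F 0) f) n ⟨
        ((v 0 • F 0) *ₛ f) n    ≈⟨ coeff (*ₛ-comm (v 0 • F 0) f) n ⟩
        (f *ₛ (v 0 • F 0)) n    ∎

  module Composition (f : Series) (f₀≈0 : f 0 ≈ 0#) where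

    private

      partial : ℕ → Series → Series
      partial N u = truncated N u (f ^ₛ_)

      partial-horner : ∀ N u n →
        partial (suc N) u n ≈ const (u 0) n + (f *ₛ partial N (tail u)) n
      partial-horner N u n = +-cong (head n) (*ₛ-truncated N (tail u) f (f ^ₛ_) n)
        where
        head : ∀ n → u 0 * 1ₛ n ≈ const (u 0) n
        head zero    = *-identityʳ _
        head (suc n) = zeroʳ _

      -- The additional term is a multiple of `f ^ₛ N`, which has order at least `N`. In Horner form
      -- the outer factor `f` lowers the coefficients to be compared, so the induction on `N`
      -- closes.
      partial-suc : ∀ N u n → n < N → partial N u n ≈ partial (suc N) u n
      partial-suc (suc N) u n (ℕ.s≤s n≤N) = begin
        partial (suc N) u n
          ≈⟨ partial-horner N u n ⟩
        const (u 0) n + (f *ₛ partial N (tail u)) n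
          ≈⟨ +-congˡ (*ₛ-contract n {f} f₀≈0
               (λ i i<n → partial-suc N (tail u) i (ℕ.<-≤-trans i<n n≤N))) ⟩
        const (u 0) n + (f *ₛ partial (suc N) (tail u)) n
          ≈⟨ partial-horner (suc N) u n ⟨
        partial (suc (suc N)) u n  ∎

      -- In `u ∘ₛ f` the number of summands varies with the coefficient; this allows any larger
      -- number, so that one truncation serves several coefficients.
      partial-stable : ∀ {n N} u → suc n ℕ.≤′ N → (u ∘ₛ f) n ≈ partial N u n
      partial-stable u ℕ.≤′-refl = refl
      partial-stable {N = suc N} u (ℕ.≤′-step n<N) =
        trans (partial-stable u n<N) (partial-suc N u _ (ℕ.≤′⇒≤ n<N))

    ∘-horner : ∀ u → u ∘ₛ f ≋ const (u 0) +ₛ f *ₛ (tail u ∘ₛ f)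
    ∘-horner u .coeff n = begin
      (u ∘ₛ f) n
        ≈⟨ partial-horner n u n ⟩
      const (u 0) n + (f *ₛ partial n (tail u)) n
        -- Only coefficients `i < n` of the inner sum matter, and for these its `n` terms are
        -- enough.
        ≈⟨ +-congˡ (*ₛ-contract n {f} f₀≈0
             (λ i i<n → sym (partial-stable (tail u) (ℕ.≤⇒≤′ i<n)))) ⟩
      const (u 0) n + (f *ₛ (tail u ∘ₛ f)) n  ∎

    ∘-congʳ : ∀ {u v} → u ≋ v → u ∘ₛ f ≋ v ∘ₛ f
    ∘-congʳ {u} {v} u≈v .coeff n = go (suc n) (f ^ₛ_) u v (coeff u≈v)
      where
      go : ∀ N F u v → (∀ k → u k ≈ v k) → truncated N u F n ≈ truncated N v F n
      go zero    F u v u≈v = refl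
      go (suc N) F u v u≈v = +-cong (*-congʳ (u≈v 0))
        (go N (λ k → F (suc k)) (tail u) (tail v) (λ k → u≈v (suc k)))

    ∘-+ : ∀ u v → (u +ₛ v) ∘ₛ f ≋ u ∘ₛ f +ₛ v ∘ₛ f
    ∘-+ u v .coeff n = go (suc n) (f ^ₛ_) u v
      where
      go : ∀ N F u v → truncated N (u +ₛ v) F n ≈ truncated N u F n + truncated N v F n
      go zero    F u v = sym (+-identityʳ 0#)
      go (suc N) F u v = trans (+-congˡ (go N (λ k → F (suc k)) (tail u) (tail v)))
        (solve 5 (λ a b c s t →
          (a :+ b) :* c :+ (s :+ t) := (a :* c :+ s) :+ (b :* c :+ t)) refl
          (u 0) (v 0) (F 0 n) (truncated N (tail u) (λ k → F (suc k)) n)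
          (truncated N (tail v) (λ k → F (suc k)) n))

    ∘-0 : 0ₛ ∘ₛ f ≋ 0ₛ
    ∘-0 .coeff n = go (suc n) (f ^ₛ_)
      where
      go : ∀ N F → truncated N 0ₛ F n ≈ 0#
      go zero    F = refl
      go (suc N) F = trans (+-cong (zeroˡ _) (go N (λ k → F (suc k)))) (+-identityʳ 0#)

    ∘-• : ∀ a u → (a • u) ∘ₛ f ≋ a • (u ∘ₛ f)
    ∘-• a u .coeff n = go (suc n) (f ^ₛ_) u
      where
      go : ∀ N F u → truncated N (a • u) F n ≈ a * truncated N u F n
      go zero    F u = sym (zeroʳ a)
      go (suc N) F u = trans (+-congˡ (go N (λ k → F (suc k)) (tail u)))
        (solve 4 (λ a b c s → a :* b :* c :+ a :* s := a :* (b :* c :+ s)) refl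
          a (u 0) (F 0 n) (truncated N (tail u) (λ k → F (suc k)) n))

    ∘-const : ∀ a → const a ∘ₛ f ≋ const a
    ∘-const a = S.trans (∘-horner (const a))
      (S.trans (S.+-cong (S.refl {const a})
        (S.trans (*ₛ-cong (S.refl {f}) ∘-0) (S.zeroʳ f))) (S.+-identityʳ (const a)))

    ∘-x : x ∘ₛ f ≋ f
    ∘-x = S.trans (∘-horner x) (S.trans (S.+-cong const-0 f*1≈f) (S.+-identityˡ f))
      where
      const-0 : const 0# ≋ 0ₛ
      const-0 .coeff zero    = refl
      const-0 .coeff (suc n) = refl
      f*1≈f : f *ₛ (tail x ∘ₛ f) ≋ f
      f*1≈f = S.trans
        (*ₛ-cong (S.refl {f}) (S.trans (∘-congʳ tail-x) (∘-const 1#))) (S.*-identityʳ f)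

    ∘-neg : ∀ u → (-ₛ u) ∘ₛ f ≋ -ₛ (u ∘ₛ f)
    ∘-neg u = Sₚ.+-inverseˡ-unique ((-ₛ u) ∘ₛ f) (u ∘ₛ f)
      (S.trans (S.sym (∘-+ (-ₛ u) u)) (S.trans (∘-congʳ (S.-‿inverseˡ u)) ∘-0))
      where module Sₚ = Algebra.Properties.Ring S.ring

    -- Expand by Horner's rule in `u`. The outer factor `f` has no constant term, so coefficient `n`
    -- needs multiplicativity for `tail u` only below `n`: a strong induction with `u` generalised,
    -- in which the bound `N` decreases.
    ∘-* : ∀ u v → (u *ₛ v) ∘ₛ f ≋ (u ∘ₛ f) *ₛ (v ∘ₛ f)
    ∘-* u v .coeff n = go n n ℕ.≤-refl u
      where
      go : ∀ N n → n ℕ.≤ N → ∀ u → ((u *ₛ v) ∘ₛ f) n ≈ ((u ∘ₛ f) *ₛ (v ∘ₛ f)) n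
      go N n n≤N u = begin
        ((u *ₛ v) ∘ₛ f) n
          ≈⟨ coeff (∘-horner (u *ₛ v)) n ⟩
        const (u 0 * v 0 + 0#) n + (f *ₛ ((u 0 • tail v +ₛ tail u *ₛ v) ∘ₛ f)) n
          ≈⟨ +-congˡ (*ₛ-contract n {f} f₀≈0 (below N n≤N)) ⟩
        const (u 0 * v 0 + 0#) n + (f *ₛ (u 0 • tv +ₛ tu *ₛ V)) n
          ≈⟨ coeff regroup n ⟩
        ((const (u 0) +ₛ f *ₛ tu) *ₛ V) n
          ≈⟨ coeff (*ₛ-cong (∘-horner u) (S.refl {V})) n ⟨
        ((u ∘ₛ f) *ₛ V) n  ∎
        where
        V  = v ∘ₛ f
        tu = tail u ∘ₛ f
        tv = tail v ∘ₛ f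
        below : ∀ N → n ℕ.≤ N →
                ((u 0 • tail v +ₛ tail u *ₛ v) ∘ₛ f) ≈[< n ] (u 0 • tv +ₛ tu *ₛ V)
        below zero ℕ.z≤n i ()
        below (suc N) n≤N i i<n = trans (coeff (∘-+ (u 0 • tail v) (tail u *ₛ v)) i)
          (+-cong (coeff (∘-• (u 0) (tail v)) i)
            (go N i (ℕ.≤-pred (ℕ.≤-trans i<n n≤N)) (tail u)))
        regroup : const (u 0 * v 0 + 0#) +ₛ f *ₛ (u 0 • tv +ₛ tu *ₛ V) ≋
                  (const (u 0) +ₛ f *ₛ tu) *ₛ V
        regroup = S.trans
          (S.+-cong (S.sym (const-const (u 0) (v 0)))
            (*ₛ-cong (S.refl {f}) (S.+-cong (S.sym (const-* (u 0) tv)) (S.refl {tu *ₛ V}))))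
          (S.trans
            (Sₛ.solve 6 (λ a b f s t w →
              a Sₛ.:* b Sₛ.:+ f Sₛ.:* (a Sₛ.:* t Sₛ.:+ s Sₛ.:* w) Sₛ.:=
              a Sₛ.:* (b Sₛ.:+ f Sₛ.:* t) Sₛ.:+ f Sₛ.:* s Sₛ.:* w) S.refl
              (const (u 0)) (const (v 0)) f tu tv V)
            (S.trans
              (S.+-cong (*ₛ-cong (S.refl {const (u 0)}) (S.sym (∘-horner v)))
                (S.refl {f *ₛ tu *ₛ V}))
              (S.sym (S.distribʳ V (const (u 0)) (f *ₛ tu)))))

  -- Reciprocals, and uniqueness of solutions of a contracting equation.

  -- ones ∘ (1 - q) is the factor by which p /ₛ q multiplies p.
  ones : Series
  ones _ = 1#

  -- `ones` is its own tail, so Horner's rule is the hypothesis of `geometric`.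
  *ₛ-reciprocal : ∀ q → q 0 ≈ 1# → q *ₛ (ones ∘ₛ (1ₛ -ₛ q)) ≋ 1ₛ
  *ₛ-reciprocal q q₀≈1 = geometric q (ones ∘ₛ (1ₛ -ₛ q))
    (Composition.∘-horner (1ₛ -ₛ q) z₀≈0 ones)
    where
    z₀≈0 : 1# - q 0 ≈ 0#
    z₀≈0 = trans (+-congˡ (-‿cong q₀≈1)) (-‿inverseʳ 1#)

  -- In coefficient `n` the four products involve `E` and `U` only below `n`, where they agree by
  -- strong induction; cancelling them leaves `E n ≈ U n`.
  contraction-unique : ∀ A B K G g E U →
    A 0 ≈ 0# → B 0 ≈ 0# → K 0 ≈ 0# → G 0 ≈ 0# →
    E +ₛ (A *ₛ E +ₛ B *ₛ (E *ₛ E)) ≋ g +ₛ (K *ₛ (E *ₛ E) +ₛ G *ₛ E) →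
    U +ₛ (A *ₛ U +ₛ B *ₛ (U *ₛ U)) ≋ g +ₛ (K *ₛ (U *ₛ U) +ₛ G *ₛ U) →
    E ≋ U
  contraction-unique A B K G g E U A₀ B₀ K₀ G₀ eqE eqU .coeff n =
    agree (suc n) n (ℕ.n<1+n n)
    where
    step : ∀ n → E ≈[< n ] U → E n ≈ U n
    step n E≈U = Rₚ.+-cancelʳ _ (E n) (U n) (begin
      E n + ((A *ₛ E) n + (B *ₛ (E *ₛ E)) n)
        ≈⟨ coeff eqE n ⟩
      g n + ((K *ₛ (E *ₛ E)) n + (G *ₛ E) n)
        ≈⟨ +-congˡ (+-cong (*ₛ-contract n {K} K₀ E²≈U²) (*ₛ-contract n {G} G₀ E≈U)) ⟩
      g n + ((K *ₛ (U *ₛ U)) n + (G *ₛ U) n)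
        ≈⟨ coeff eqU n ⟨
      U n + ((A *ₛ U) n + (B *ₛ (U *ₛ U)) n)
        ≈⟨ +-congˡ (+-cong (*ₛ-contract n {A} A₀ E≈U) (*ₛ-contract n {B} B₀ E²≈U²)) ⟨
      U n + ((A *ₛ E) n + (B *ₛ (E *ₛ E)) n)  ∎)
      where
      E²≈U² : (E *ₛ E) ≈[< n ] (U *ₛ U)
      E²≈U² i i<n = *ₛ-agree i {E} {U} {E} {U} below below
        where
        below : E ≈[< suc i ] U
        below j j≤i = E≈U j (ℕ.<-≤-trans j≤i i<n)
    agree : ∀ n → E ≈[< n ] U
    agree (suc n) i (ℕ.s≤s i≤n) = step i (λ j j<i → agree n j (ℕ.<-≤-trans j<i i≤n))

  -- The Euler operator x d/dx and the quadratic equation of the Catalan series.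

  θ : Series → Series
  θ p n = n × p n

  θ-+ : ∀ p q → θ (p +ₛ q) ≋ θ p +ₛ θ q
  θ-+ p q .coeff n = go n
    where
    go : ∀ k → k × (p n + q n) ≈ k × p n + k × q n
    go zero    = sym (+-identityʳ 0#)
    go (suc k) = trans (+-congˡ (go k))
      (solve 4 (λ a b s t → (a :+ b) :+ (s :+ t) := (a :+ s) :+ (b :+ t)) refl
        (p n) (q n) (k × p n) (k × q n))

  θ-* : ∀ p q → θ (p *ₛ q) ≋ θ p *ₛ q +ₛ p *ₛ θ q
  θ-* p q .coeff n = go n p
    where
    go : ∀ n p → n × (p *ₛ q) n ≈ (θ p *ₛ q) n + (p *ₛ θ q) n
    go zero    p = sym (trans
      (+-cong (*ₛ-coeff₀≈0 (θ p) q refl)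
        (trans (coeff (*ₛ-comm p (θ q)) 0) (*ₛ-coeff₀≈0 (θ q) p refl)))
      (+-identityʳ 0#))
    go (suc n) p = begin
      suc n × (p 0 * q (suc n) + (tail p *ₛ q) n)
        -- On constant sequences, `θ-+` at index `suc n` says that the multiple distributes over a
        -- sum.
        ≈⟨ coeff (θ-+ (λ _ → p 0 * q (suc n)) (λ _ → (tail p *ₛ q) n)) (suc n) ⟩
      suc n × (p 0 * q (suc n)) + ((tail p *ₛ q) n + n × (tail p *ₛ q) n)
        ≈⟨ +-cong (sym (×-comm-* (suc n) (p 0) (q (suc n)))) (+-congˡ (go n (tail p))) ⟩
      p 0 * θ q (suc n) + ((tail p *ₛ q) n + ((θ (tail p) *ₛ q) n + (tail p *ₛ θ q) n))
        -- The summand `con 0 :* b` is the constant term of `θ p` at work, and `tail (θ p)` computes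
        -- to `tail p +ₛ θ (tail p)`.
        ≈⟨ solve 5 (λ a b s t u →
             a :+ (s :+ (t :+ u)) := con 0 :* b :+ (s :+ t) :+ (a :+ u)) refl
             (p 0 * θ q (suc n)) (q (suc n)) ((tail p *ₛ q) n)
             ((θ (tail p) *ₛ q) n) ((tail p *ₛ θ q) n) ⟩
      0# * q (suc n) + ((tail p *ₛ q) n + (θ (tail p) *ₛ q) n) + (p *ₛ θ q) (suc n)
        ≈⟨ +-congʳ (+-congˡ (coeff (*ₛ-distribʳ q (tail p) (θ (tail p))) n)) ⟨
      (θ p *ₛ q) (suc n) + (p *ₛ θ q) (suc n)  ∎

  θ-1 : θ 1ₛ ≋ 0ₛ
  θ-1 .coeff zero    = refl
  θ-1 .coeff (suc n) = trans (+-identityˡ _) (×-zero n)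
    where
    ×-zero : ∀ n → n × 0# ≈ 0#
    ×-zero zero    = refl
    ×-zero (suc n) = trans (+-identityˡ _) (×-zero n)

  θ-x : θ x ≋ x
  θ-x .coeff zero          = refl
  θ-x .coeff (suc zero)    = +-identityʳ 1#
  θ-x .coeff (suc (suc n)) = coeff θ-1 (suc (suc n))

  -- `B` will be the central binomial coefficients. The factor `4n + 2` is written as a sum so that
  -- `×-homo-+` splits it into `four (θ p) +ₛ (p +ₛ p)`.
  module _ (cancel : ∀ n {a b} → suc n × a ≈ suc n × b → a ≈ b)
           (B : ℕ → ℕ) (B₀≡1 : B 0 ≡ 1)
           (B-suc : ∀ n → suc n ℕ.* B (suc n) ≡ (n ℕ.+ n ℕ.+ (n ℕ.+ n) ℕ.+ 2) ℕ.* B n)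
           (p : Series) (p-B : ∀ n → suc n × p n ≈ B n × 1#)
           where

    private
      four : Series → Series
      four t = (t +ₛ t) +ₛ (t +ₛ t)

      q : Series
      q = 1ₛ +ₛ x *ₛ (p *ₛ p)

      p₀≈1 : p 0 ≈ 1#
      p₀≈1 = cancel 0 (trans (p-B 0) (×-congˡ B₀≡1))

      -- Multiplying by `suc n` brings in `B`, whose recurrence then applies.
      rec : ∀ n → suc (suc n) × p (suc n) ≈ (n ℕ.+ n ℕ.+ (n ℕ.+ n) ℕ.+ 2) × p n
      rec n = cancel n (begin
        suc n × (suc (suc n) × p (suc n))  ≈⟨ ×-congʳ (suc n) (p-B (suc n)) ⟩
        suc n × (B (suc n) × 1#)           ≈⟨ ×-assocˡ 1# (suc n) (B (suc n)) ⟩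
        (suc n ℕ.* B (suc n)) × 1#         ≈⟨ ×-congˡ (B-suc n) ⟩
        (m ℕ.* B n) × 1#                   ≈⟨ ×-assocˡ 1# m (B n) ⟨
        m × (B n × 1#)                     ≈⟨ ×-congʳ m (p-B n) ⟨
        m × (suc n × p n)                  ≈⟨ ×-assocˡ (p n) m (suc n) ⟩
        (m ℕ.* suc n) × p n                ≈⟨ ×-congˡ (ℕ.*-comm m (suc n)) ⟩
        (suc n ℕ.* m) × p n                ≈⟨ ×-assocˡ (p n) (suc n) m ⟨
        suc n × (m × p n)                  ∎)
        where m = n ℕ.+ n ℕ.+ (n ℕ.+ n) ℕ.+ 2

      p-eq : p +ₛ θ p ≋ 1ₛ +ₛ x *ₛ (four (θ p) +ₛ (p +ₛ p))
      p-eq .coeff zero    = +-cong p₀≈1 (sym (x*-coeff₀ (four (θ p) +ₛ (p +ₛ p))))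
      p-eq .coeff (suc n) = begin
        suc (suc n) × p (suc n)
          ≈⟨ rec n ⟩
        (n ℕ.+ n ℕ.+ (n ℕ.+ n) ℕ.+ 2) × p n
          ≈⟨ ×-homo-+ (p n) (n ℕ.+ n ℕ.+ (n ℕ.+ n)) 2 ⟩
        (n ℕ.+ n ℕ.+ (n ℕ.+ n)) × p n + 2 × p n
          ≈⟨ +-cong (trans (×-homo-+ (p n) (n ℕ.+ n) (n ℕ.+ n))
               (+-cong (×-homo-+ (p n) n n) (×-homo-+ (p n) n n)))
               (+-congˡ (+-identityʳ (p n))) ⟩
        (four (θ p) +ₛ (p +ₛ p)) n
          ≈⟨ x*-coeff (four (θ p) +ₛ (p +ₛ p)) n ⟨
        (x *ₛ (four (θ p) +ₛ (p +ₛ p))) (suc n)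
          ≈⟨ +-identityˡ _ ⟨
        0# + (x *ₛ (four (θ p) +ₛ (p +ₛ p))) (suc n)  ∎

      θq-eq : θ q ≋ x *ₛ (p *ₛ p) +ₛ x *ₛ (θ p *ₛ p +ₛ p *ₛ θ p)
      θq-eq = S.trans (θ-+ 1ₛ (x *ₛ (p *ₛ p)))
        (S.trans (S.+-cong θ-1 (S.trans (θ-* x (p *ₛ p))
          (S.+-cong (*ₛ-cong θ-x (S.refl {p *ₛ p})) (*ₛ-cong (S.refl {x}) (θ-* p p)))))
          (S.+-identityˡ _))

      balance : (q +ₛ θ q) +ₛ x *ₛ four (θ p) ≋ (p +ₛ θ p) +ₛ x *ₛ four (θ q)
      balance = catalan-ode x p (θ p) q (θ q) p-eq S.refl θq-eq

    -- Coefficient `n + 1` of `balance` reads `(n + 2) q(n + 1) + 4n p(n) = (n + 2) p(n + 1) + 4n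
    -- q(n)`, so equality of `q` and `p` passes from `n` to `n + 1`.
    centralBinomial⇒quadratic : p ≋ 1ₛ +ₛ x *ₛ (p *ₛ p)
    centralBinomial⇒quadratic .coeff n = sym (go n)
      where
      go : ∀ n → q n ≈ p n
      go zero    = trans (trans (+-congˡ (x*-coeff₀ (p *ₛ p))) (+-identityʳ 1#)) (sym p₀≈1)
      go (suc n) = cancel (suc n) (Rₚ.+-cancelʳ _ _ _ (begin
        suc (suc n) × q (suc n) + four (θ p) n
          ≈⟨ +-congˡ (x*-coeff (four (θ p)) n) ⟨
        suc (suc n) × q (suc n) + (x *ₛ four (θ p)) (suc n)
          ≈⟨ coeff balance (suc n) ⟩
        suc (suc n) × p (suc n) + (x *ₛ four (θ q)) (suc n)
          ≈⟨ +-congˡ (x*-coeff (four (θ q)) n) ⟩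
        suc (suc n) × p (suc n) + four (θ q) n
          ≈⟨ +-congˡ (+-cong (+-cong θ≈ θ≈) (+-cong θ≈ θ≈)) ⟩
        suc (suc n) × p (suc n) + four (θ p) n  ∎))
        where
        θ≈ : n × q n ≈ n × p n
        θ≈ = ×-congʳ n (go n)

  -- The array of `g`, for any series `C` satisfying the Catalan equation.

  module BellArray (C : Series) (C-eq : C ≋ 1ₛ +ₛ x *ₛ (C *ₛ C)) (a b c : Carrier) where

    private
      d s u J I T : Series
      d = 1ₛ -ₛ const a *ₛ x -ₛ const b *ₛ x ^ₛ 2
      s = x ^ₛ 2 *ₛ (const b +ₛ const c *ₛ x)
      u = -ₛ s /ₛ d ^ₛ 2
      J = ones ∘ₛ (1ₛ -ₛ d)
      I = ones ∘ₛ (1ₛ -ₛ d ^ₛ 2)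
      T = C ∘ₛ u

    g : Series
    g = (1ₛ /ₛ d) *ₛ (C ∘ₛ (-ₛ (x ^ₛ 2 *ₛ (const b +ₛ const c *ₛ x)) /ₛ d ^ₛ 2))

    private
      ^2₀ : (x ^ₛ 2) 0 ≈ 0#
      ^2₀ = x*-coeff₀ (x ^ₛ 1)

      d₀≈1 : d 0 ≈ 1#
      d₀≈1 = begin
        1# - (const a *ₛ x) 0 - (const b *ₛ x ^ₛ 2) 0
          ≈⟨ +-cong (+-congˡ (-‿cong (trans (coeff (const-* a x) 0) (zeroʳ a))))
               (-‿cong (trans (coeff (const-* b (x ^ₛ 2)) 0) (trans (*-congˡ ^2₀) (zeroʳ b)))) ⟩
        1# - 0# - 0#
          ≈⟨ +-cong (trans (+-congˡ Rₚ.-0#≈0#) (+-identityʳ 1#)) Rₚ.-0#≈0# ⟩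
        1# + 0#
          ≈⟨ +-identityʳ 1# ⟩
        1#  ∎

      d²₀≈1 : (d ^ₛ 2) 0 ≈ 1#
      d²₀≈1 = begin
        (d ^ₛ 2) 0          ≈⟨ *ₛ-coeff₀ d (d ^ₛ 1) ⟩
        d 0 * (d ^ₛ 1) 0    ≈⟨ *-cong d₀≈1 (trans (*ₛ-coeff₀ d 1ₛ) (trans (*-identityʳ (d 0)) d₀≈1)) ⟩
        1# * 1#             ≈⟨ *-identityʳ 1# ⟩
        1#                  ∎

      s₀≈0 : s 0 ≈ 0#
      s₀≈0 = *ₛ-coeff₀≈0 (x ^ₛ 2) (const b +ₛ const c *ₛ x) ^2₀

      u₀≈0 : u 0 ≈ 0#
      u₀≈0 = *ₛ-coeff₀≈0 (-ₛ s) I (trans (-‿cong s₀≈0) Rₚ.-0#≈0#)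

      T-eq : T ≋ 1ₛ +ₛ u *ₛ (T *ₛ T)
      T-eq = S.trans (∘-congʳ C-eq) (S.trans (∘-+ 1ₛ (x *ₛ (C *ₛ C)))
        (S.+-cong (∘-const 1#) (S.trans (∘-* x (C *ₛ C)) (*ₛ-cong ∘-x (∘-* C C)))))
        where open Composition u u₀≈0

      -- This is `1ₛ -ₛ d`, written without subtraction.
      e : Series
      e = const b *ₛ x ^ₛ 2 +ₛ const a *ₛ x

      g-eq : g +ₛ s *ₛ (g *ₛ g) ≋ 1ₛ +ₛ e *ₛ g
      g-eq = bell-equation (const a *ₛ x) (const b *ₛ x ^ₛ 2) s {J} {I} {T}
        (*ₛ-reciprocal d d₀≈1) (*ₛ-reciprocal (d ^ₛ 2) d²₀≈1) T-eq

      e₀≈0 : e 0 ≈ 0#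
      e₀≈0 = trans (+-cong
        (trans (coeff (const-* b (x ^ₛ 2)) 0) (trans (*-congˡ ^2₀) (zeroʳ b)))
        (trans (coeff (const-* a x) 0) (zeroʳ a))) (+-identityʳ 0#)

    -- Read off from the constant term of `g-eq`, since `s` and `e` have none.
    g₀≈1 : g 0 ≈ 1#
    g₀≈1 = begin
      g 0                          ≈⟨ +-identityʳ (g 0) ⟨
      g 0 + 0#                     ≈⟨ +-congˡ (*ₛ-coeff₀≈0 s (g *ₛ g) s₀≈0) ⟨
      g 0 + (s *ₛ (g *ₛ g)) 0      ≈⟨ coeff g-eq 0 ⟩
      1# + (e *ₛ g) 0              ≈⟨ +-congˡ (*ₛ-coeff₀≈0 e g e₀≈0) ⟩
      1# + 0#                      ≈⟨ +-identityʳ 1# ⟩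
      1#                           ∎

    private
      y h : Series
      y = -ₛ (x *ₛ g)
      h = g ∘ₛ y

      y₀≈0 : y 0 ≈ 0#
      y₀≈0 = trans (-‿cong (x*-coeff₀ g)) Rₚ.-0#≈0#

      open Composition y y₀≈0

      x²∘y : (x ^ₛ 2) ∘ₛ y ≋ y ^ₛ 2
      x²∘y = S.trans (∘-* x (x ^ₛ 1)) (*ₛ-cong ∘-x
        (S.trans (∘-* x 1ₛ) (*ₛ-cong ∘-x (∘-const 1#))))

      const*∘y : ∀ k p {q} → p ∘ₛ y ≋ q → (const k *ₛ p) ∘ₛ y ≋ const k *ₛ q
      const*∘y k p p∘y = S.trans (∘-* (const k) p) (*ₛ-cong (∘-const k) p∘y)

      -- Substituting `y` respects the ring operations, so it carries `g-eq` to this.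
      h-eq : h +ₛ (y ^ₛ 2 *ₛ (const b +ₛ const c *ₛ y)) *ₛ (h *ₛ h) ≋
             1ₛ +ₛ (const b *ₛ y ^ₛ 2 +ₛ const a *ₛ y) *ₛ h
      h-eq = S.trans (S.sym lhs) (S.trans (∘-congʳ g-eq) rhs)
        where
        lhs = S.trans (∘-+ g (s *ₛ (g *ₛ g))) (S.+-cong (S.refl {h})
          (S.trans (∘-* s (g *ₛ g)) (*ₛ-cong
            (S.trans (∘-* (x ^ₛ 2) (const b +ₛ const c *ₛ x))
              (*ₛ-cong x²∘y (S.trans (∘-+ (const b) (const c *ₛ x))
                (S.+-cong (∘-const b) (const*∘y c x ∘-x)))))
            (∘-* g g))))
        rhs = S.trans (∘-+ 1ₛ (e *ₛ g)) (S.+-cong (∘-const 1#)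
          (S.trans (∘-* e g) (*ₛ-cong
            (S.trans (∘-+ (const b *ₛ x ^ₛ 2) (const a *ₛ x))
              (S.+-cong (const*∘y b (x ^ₛ 2) x²∘y) (const*∘y a x ∘-x)))
            (S.refl {h}))))

      gh≋1 : g *ₛ h ≋ 1ₛ
      gh≋1 = contraction-unique
        (x *ₛ (const a *ₛ g)) (x *ₛ (x *ₛ (const b *ₛ g)))
        (x *ₛ (x *ₛ (x *ₛ (const c *ₛ (g *ₛ g))))) (x *ₛ (x *ₛ (const b *ₛ (g *ₛ g))))
        g (g *ₛ h) 1ₛ
        (x*-coeff₀ (const a *ₛ g))
        (x*-coeff₀ (x *ₛ (const b *ₛ g)))
        (x*-coeff₀ (x *ₛ (x *ₛ (const c *ₛ (g *ₛ g)))))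
        (x*-coeff₀ (x *ₛ (const b *ₛ (g *ₛ g))))
        (quadratic-at-product (const a) (const b) (const c) x g h h-eq)
        (quadratic-at-1 (const a) (const b) (const c) x g g-eq)

      y∘y≋x : y ∘ₛ y ≋ x
      y∘y≋x = S.trans (∘-neg (x *ₛ g))
        (S.trans (S.-‿cong (S.trans (∘-* x g) (*ₛ-cong ∘-x (S.refl {h}))))
          (reflected-product x g h gh≋1))

    involutory : Involutory g
    -- By computation the square of the array is `(g *ₛ h , y ∘ₛ y)`.
    involutory = g₀≈1 , λ n k → coeff (*ₛ-cong gh≋1 (^ₛ-cong k y∘y≋x)) n

-- Central binomial coefficients.

open import Data.Nat.Combinatorics using (_C_; nCk≡n!/k![n-k]!; k![n∸k]!∣n!)

centralBinomial : ℕ → ℕ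
centralBinomial n = (2 ℕ.* n) C n

centralBinomial-! : ∀ n → centralBinomial n ℕ.* (n ! ℕ.* n !) ≡ (2 ℕ.* n) !
centralBinomial-! n = ≡.subst (λ k → centralBinomial n ℕ.* (n ! ℕ.* k !) ≡ (2 ℕ.* n) !)
  (≡.trans (ℕ.m+n∸m≡n n (n ℕ.+ 0)) (ℕ.+-identityʳ n))
  (≡.trans (≡.cong (ℕ._* (n ! ℕ.* (2 ℕ.* n ℕ.∸ n) !)) (nCk≡n!/k![n-k]! n≤2n))
    (ℕ.m/n*n≡m {{_}} (k![n∸k]!∣n! n≤2n)))
  where
  n≤2n : n ℕ.≤ 2 ℕ.* n
  n≤2n = ℕ.m≤m+n n (n ℕ.+ 0)

-- Multiplied by `(n + 1) (n!)²`, both sides become `(2n + 2)!`, because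
-- `(2n + 2) (2n + 1) = (4n + 2) (n + 1)`.
centralBinomial-suc : ∀ n → suc n ℕ.* centralBinomial (suc n) ≡
                      (n ℕ.+ n ℕ.+ (n ℕ.+ n) ℕ.+ 2) ℕ.* centralBinomial n
centralBinomial-suc n = ℕ.*-cancelʳ-≡ _ _ (suc n ℕ.* (n ! ℕ.* n !)) {{nz}} (begin
  suc n ℕ.* B′ ℕ.* (suc n ℕ.* (n ! ℕ.* n !))
    ≡⟨ regroup (suc n) B′ (n !) ⟩
  B′ ℕ.* (suc n ! ℕ.* suc n !)
    ≡⟨ centralBinomial-! (suc n) ⟩
  (2 ℕ.* suc n) !
    ≡⟨ ≡.cong (_!) (ℕ.*-suc 2 n) ⟩
  suc (suc (2 ℕ.* n)) ℕ.* (suc (2 ℕ.* n) ℕ.* (2 ℕ.* n) !)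
    ≡⟨ ≡.cong (λ k → suc (suc (2 ℕ.* n)) ℕ.* (suc (2 ℕ.* n) ℕ.* k)) (centralBinomial-! n) ⟨
  suc (suc (2 ℕ.* n)) ℕ.* (suc (2 ℕ.* n) ℕ.* (B ℕ.* (n ! ℕ.* n !)))
    ≡⟨ expand n B (n !) ⟩
  (n ℕ.+ n ℕ.+ (n ℕ.+ n) ℕ.+ 2) ℕ.* B ℕ.* (suc n ℕ.* (n ! ℕ.* n !))  ∎)
  where
  open ≡.≡-Reasoning
  B = centralBinomial n
  B′ = centralBinomial (suc n)
  nz : ℕ.NonZero (suc n ℕ.* (n ! ℕ.* n !))
  nz = ℕ.m*n≢0 (suc n) (n ! ℕ.* n !) {{_}} {{n ℕ.!* n !≢0}}
  regroup : ∀ m b f → m ℕ.* b ℕ.* (m ℕ.* (f ℕ.* f)) ≡ b ℕ.* ((m ℕ.* f) ℕ.* (m ℕ.* f))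
  regroup = ℕ-Solver.solve-∀
  expand : ∀ n b f → suc (suc (2 ℕ.* n)) ℕ.* (suc (2 ℕ.* n) ℕ.* (b ℕ.* (f ℕ.* f))) ≡
                     (n ℕ.+ n ℕ.+ (n ℕ.+ n) ℕ.+ 2) ℕ.* b ℕ.* (suc n ℕ.* (f ℕ.* f))
  expand = ℕ-Solver.solve-∀

-- Integer multiples of fractions, in the rationals and in `ℂ`.

/-+ : ∀ i j n → i ℚ./ suc n ℚ.+ j ℚ./ suc n ≡ (i ℤ.+ j) ℚ./ suc n
/-+ i j n = ℚ.toℚᵘ-injective (begin
  toℚᵘ (i ℚ./ suc n ℚ.+ j ℚ./ suc n)
    ≈⟨ ℚ.toℚᵘ-homo-+ (i ℚ./ suc n) (j ℚ./ suc n) ⟩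
  toℚᵘ (i ℚ./ suc n) ℚᵘ.+ toℚᵘ (j ℚ./ suc n)
    ≈⟨ ℚᵘ.+-cong (ℚ.toℚᵘ-fromℚᵘ (mkℚᵘ i n)) (ℚ.toℚᵘ-fromℚᵘ (mkℚᵘ j n)) ⟩
  mkℚᵘ i n ℚᵘ.+ mkℚᵘ j n
    ≈⟨ *≡* (common i j (+ suc n)) ⟩
  mkℚᵘ (i ℤ.+ j) n
    ≈⟨ ℚ.toℚᵘ-fromℚᵘ (mkℚᵘ (i ℤ.+ j) n) ⟨
  toℚᵘ ((i ℤ.+ j) ℚ./ suc n)  ∎)
  where
  open Relation.Binary.Reasoning.Setoid ℚᵘ.≃-setoid
  common : ∀ i j d → (i ℤ.* d ℤ.+ j ℤ.* d) ℤ.* d ≡ (i ℤ.+ j) ℤ.* (d ℤ.* d)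
  common = ℤ-Solver.solve-∀

open import Defs

private module ℂᴿ = CommutativeRing ℂ-commutativeRing
open Algebra.Properties.Semiring.Mult ℂᴿ.semiring

fromℚ-+ : ∀ p q → fromℚ p +ᶜ fromℚ q ≈ᶜ fromℚ (p ℚ.+ q)
-- Both sides have the same sequences by computation, and nearness of a sequence to itself is its
-- Cauchy property.
fromℚ-+ p q = ⟨ ℝ.cauchy (fromℚᴿ (p ℚ.+ q)) ⟩ , ⟨ ℝ.cauchy (fromℚᴿ 0ℚ) ⟩

fromℚ-× : ∀ k m n → k × fromℚ (+ m ℚ./ suc n) ≈ᶜ fromℚ (+ (k ℕ.* m) ℚ./ suc n)
fromℚ-× zero    m n = ℂᴿ.reflexive (≡.cong fromℚ (ℚ.fromℚᵘ-cong {mkℚᵘ (+ 0) 0} {mkℚᵘ (+ 0) n} (*≡* ≡.refl)))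
fromℚ-× (suc k) m n = ℂᴿ.trans (ℂᴿ.+-congˡ (fromℚ-× k m n))
  (ℂᴿ.trans (fromℚ-+ (+ m ℚ./ suc n) (+ (k ℕ.* m) ℚ./ suc n))
    (ℂᴿ.reflexive (≡.cong fromℚ (/-+ (+ m) (+ (k ℕ.* m)) n))))

-- With `m` the central binomial coefficient this is the hypothesis `p-B` for `catalan`; with
-- `m = 1` it inverts `suc n` in `ℂ`.
suc×fromℚ-/suc : ∀ n m → suc n × fromℚ (+ m ℚ./ suc n) ≈ᶜ m × fromℚ 1ℚ
suc×fromℚ-/suc n m = ℂᴿ.trans (fromℚ-× (suc n) m n)
  (ℂᴿ.trans (ℂᴿ.reflexive (≡.cong fromℚ cancelled)) (ℂᴿ.sym (fromℚ-× m 1 0)))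
  where
  cancelled : + (suc n ℕ.* m) ℚ./ suc n ≡ + (m ℕ.* 1) ℚ./ 1
  cancelled = ℚ.fromℚᵘ-cong {mkℚᵘ (+ (suc n ℕ.* m)) n} {mkℚᵘ (+ (m ℕ.* 1)) 0} (*≡* (begin
    + (suc n ℕ.* m) ℤ.* + 1     ≡⟨ ℤ.pos-* (suc n ℕ.* m) 1 ⟨
    + (suc n ℕ.* m ℕ.* 1)       ≡⟨ ≡.cong +_ (swap (suc n) m) ⟩
    + (m ℕ.* 1 ℕ.* suc n)       ≡⟨ ℤ.pos-* (m ℕ.* 1) (suc n) ⟩
    + (m ℕ.* 1) ℤ.* + suc n     ∎))
    where
    open ≡.≡-Reasoning
    swap : ∀ k m → k ℕ.* m ℕ.* 1 ≡ m ℕ.* 1 ℕ.* k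
    swap = ℕ-Solver.solve-∀

suc×-cancel : ∀ n {z w} → suc n × z ≈ᶜ suc n × w → z ≈ᶜ w
suc×-cancel n {z} {w} eq = begin
  z                       ≈⟨ unscale z ⟨
  r *ᶜ (suc n × z)        ≈⟨ ℂᴿ.*-congˡ {r} eq ⟩
  r *ᶜ (suc n × w)        ≈⟨ unscale w ⟩
  w                       ∎
  where
  open Relation.Binary.Reasoning.Setoid ℂᴿ.setoid
  r = fromℚ (+ 1 ℚ./ suc n)
  unscale : ∀ z → r *ᶜ (suc n × z) ≈ᶜ z
  unscale z = begin
    r *ᶜ (suc n × z)     ≈⟨ ×-comm-* (suc n) r z ⟩
    suc n × (r *ᶜ z)     ≈⟨ ×-assoc-* (suc n) r z ⟨
    (suc n × r) *ᶜ z     ≈⟨ ℂᴿ.*-congʳ {z} (ℂᴿ.trans (suc×fromℚ-/suc n 1) (×-homo-1 (fromℚ 1ℚ))) ⟩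
    fromℚ 1ℚ *ᶜ z        ≈⟨ ℂᴿ.*-identityˡ z ⟩
    z                    ∎

-- The Catalan equation over `ℂ` and the conclusion for `gSeries`.

private module ℂ[[x]] = PowerSeries ℂ-commutativeRing

open ℂ[[x]] using (_≋_)

catalan-equation : catalan ≋ 1ₛ +ₛ x *ₛ (catalan *ₛ catalan)
catalan-equation = ℂ[[x]].centralBinomial⇒quadratic suc×-cancel
  centralBinomial ≡.refl centralBinomial-suc
  catalan (λ n → suc×fromℚ-/suc n (centralBinomial n))

private module Bell = ℂ[[x]].BellArray catalan catalan-equation

gSeries≡g : ∀ a b c → gSeries a b c ≡ Bell.g a b c
gSeries≡g a b c = ≡.refl

-- The series are transported explicitly: unfolding Involutory on both sides
-- to compare them is prohibitively expensive.
proposition18 : (a b c : ℂ) → Involutory (gSeries a b c)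
proposition18 a b c = ≡.subst Involutory (≡.sym (gSeries≡g a b c)) (Bell.involutory a b c)
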